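{- Let $G$ be a connected finite simple graph, let $M$ be a generalized Laplacian on $G$ with eigenvalues $\lambda_1\le\cdots\le\lambda_n$ (listed with multiplicity, $n=|V_G|$), and suppose that $\lambda_k$ is a simple eigenvalue of $M$ (multiplicity one). Let $\mathbf f_k$ be an eigenvector of $M$ with eigenvalue $\lambda_k$ such that $$\mathrm{Urschel}(\mathbf f_k)=\{v\in V_G : \mathbf f_k(v)=0\}$$ is nonempty, and such that every Urschel vertex of $\mathbf f_k$ is shallow (i.e. $\mathbf f_k$ has no deep Urschel vertices). Then for any vector $\mathbf f_{k,1}\in\mathbb R^{V_G}$ that vanishes at all vertices outside $\mathrm{Urschel}(\mathbf f_k)$, there is a matrix $M_1\in\mathbb R^{V_G\times V_G}$ supported on $G$ such that $$\mathbf f_{k,1}=(M-\lambda_k I)^+M_1\mathbf f_k .$$ In particular, such an $\mathbf f_{k,1}$ can be found with any specified sign pattern on the Urschel vertices of $\mathbf f_k$. Hence $$\mathrm{UN}_{\max}(\mathbf f_k)\le k .$$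
   Context: Graphs $G=(V_G,E_G)$ are finite and simple. A matrix $M\in\mathbb R^{V_G\times V_G}$ is supported on $G$ if $M(u,v)\neq 0$ implies $u=v$ or $\{u,v\}\in E_G$. A generalized Laplacian on $G$ is a symmetric real matrix $M$ supported on $G$ with $M(u,v)<0$ for all $\{u,v\}\in E_G$; its eigenvalues are ordered $\lambda_1\le\lambda_2\le\cdots\le\lambda_n$ with multiplicity. $(\cdot)^+$ denotes the Moore–Penrose pseudoinverse. For a nonzero $\mathbf f:V_G\to\mathbb R$, a vertex $v$ is an Urschel vertex of $\mathbf f$ if $\mathbf f(v)=0$, and a non-Urschel vertex otherwise. An Urschel vertex is shallow if it is adjacent to at least one non-Urschel vertex, and deep otherwise. For $\mathbf f:V_G\to\mathbb R$, a strong nodal domain of $\mathbf f$ is a connected component of the subgraph of $G$ induced on $\{v:\mathbf f(v)>0\}$ or of the subgraph induced on $\{v:\mathbf f(v)<0\}$; $\mathrm{SND}(\mathbf f)$ is the number of strong nodal domains. A signing of $\mathbf f$ is a nowhere-zero function $\tilde{\mathbf f}:V_G\to\mathbb R$ such that $\tilde{\mathbf f}(v)>0$ whenever $\mathbf f(v)>0$ and $\tilde{\mathbf f}(v)<0$ whenever $\mathbf f(v)<0$. The maximum Urschel number is $\mathrm{UN}_{\max}(\mathbf f)=\max\{\mathrm{SND}(\tilde{\mathbf f}) : \tilde{\mathbf f}\text{ is a signing of }\mathbf f\}$. -}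

module Defs where

open import Level using (0ℓ)
open import Algebra.Bundles using (CommutativeRing)
open import Data.Fin.Base using (Fin) renaming (_≤_ to _≤ᶠ_)
open import Data.Fin.Properties using () renaming (_≟_ to _≟ᶠ_)
open import Data.List.Base using (length; filter; allFin)
open import Data.Nat.Base as ℕ using (ℕ)
open import Data.Product.Base using (∃; ∃₂; _×_; _,_; proj₁)
open import Data.Vec.Functional using (Vector)
open import Function.Bundles using (Bijection)
open import Relation.Binary.Bundles using (Setoid)
open import Relation.Binary.Construct.Closure.ReflexiveTransitive
  using (Star; ε; _◅◅_; reverse)
open import Relation.Binary.Core using (Rel)
open import Relation.Binary.Definitions using (Decidable; Irreflexive; Symmetric)
open import Relation.Binary.PropositionalEquality as ≡ using (_≡_; _≢_)
open import Relation.Binary.Structures using (IsStrictTotalOrder)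
open import Relation.Nullary.Decidable using (does)
open import Relation.Nullary.Negation using (¬_)
open import Relation.Unary using (Pred)
open import Data.Bool.Base using (if_then_else_)
import Algebra.Properties.CommutativeMonoid.Sum
import Relation.Binary.Construct.StrictToNonStrict

-- The library has no real numbers, so they enter axiomatically, as a
-- Dedekind-complete ordered field (unique up to isomorphism).  The order is
-- trichotomous, as for the classical reals; equality is a setoid equality, so
-- that e.g. Cauchy sequences of rationals are a model given excluded middle.
record Reals : Set₁ where
  infix 4 _<_
  field
    commutativeRing : CommutativeRing 0ℓ 0ℓ

  open CommutativeRing commutativeRing public

  field
    _<_                : Rel Carrier 0ℓ
    isStrictTotalOrder : IsStrictTotalOrder _≈_ _<_

  open IsStrictTotalOrder isStrictTotalOrder public
    using (compare; _≟_; _<?_)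
  open Relation.Binary.Construct.StrictToNonStrict _≈_ _<_ public
    using (_≤_)

  field
    0<1     : 0# < 1#
    +-monoˡ : ∀ {x y} z → x < y → x + z < y + z
    *-pos   : ∀ {x y} → 0# < x → 0# < y → 0# < x * y
    inverse : ∀ x → ¬ (x ≈ 0#) → ∃ λ y → x * y ≈ 1#

  UpperBound : Pred Carrier 0ℓ → Pred Carrier 0ℓ
  UpperBound S b = ∀ {x} → S x → x ≤ b

  field
    supremum : (S : Pred Carrier 0ℓ) → ∃ S → ∃ (UpperBound S) →
               ∃ λ s → UpperBound S s × (∀ {b} → UpperBound S b → s ≤ b)

record Graph (n : ℕ) : Set₁ where
  field
    Adj    : Rel (Fin n) 0ℓ
    sym    : Symmetric Adj
    irrefl : Irreflexive _≡_ Adj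
    adj?   : Decidable Adj

module _ {n : ℕ} (G : Graph n) where
  open Graph G

  Connected : Set
  Connected = ∀ u v → Star Adj u v

  -- One step of a walk in the subgraph of G induced on P.
  InducedStep : Pred (Fin n) 0ℓ → Rel (Fin n) 0ℓ
  InducedStep P u v = P u × P v × Adj u v

  -- The vertices of the subgraph induced on P up to being joined by a walk: the
  -- elements of this setoid are its connected components.  Vertices are compared
  -- by their first projections only, so the proofs of P are irrelevant.
  components : Pred (Fin n) 0ℓ → Setoid 0ℓ 0ℓ
  components P = record
    { Carrier       = ∃ P
    ; _≈_           = λ x y → Star (InducedStep P) (proj₁ x) (proj₁ y)
    ; isEquivalence = record
      { refl  = ε
      ; sym   = reverse λ (p , q , a) → q , p , sym a
      ; trans = _◅◅_
      }
    }

  ComponentCount : Pred (Fin n) 0ℓ → ℕ → Set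
  ComponentCount P m = Bijection (components P) (≡.setoid (Fin m))

data SignValue : Set where
  negative null positive : SignValue

module OverReals (R : Reals) where
  open Reals R
  open Algebra.Properties.CommutativeMonoid.Sum +-commutativeMonoid using (sum-syntax)

  private
    variable
      n : ℕ

  HasSign : SignValue → Pred Carrier 0ℓ
  HasSign negative x = x < 0#
  HasSign null     x = x ≈ 0#
  HasSign positive x = 0# < x

  infix  4 _≋_ _≋ᴹ_
  infixr 7 _·_
  infixl 7 _⊗_
  infix  8 _ᵀ
  infixl 6 _-[_]I

  _≋_ : Rel (Vector Carrier n) 0ℓ
  f ≋ g = ∀ v → f v ≈ g v

  Matrix : ℕ → Set
  Matrix n = Fin n → Fin n → Carrier

  _≋ᴹ_ : Rel (Matrix n) 0ℓ
  A ≋ᴹ B = ∀ u v → A u v ≈ B u v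

  _·_ : Matrix n → Vector Carrier n → Vector Carrier n
  _·_ {n} A f u = ∑[ v < n ] (A u v * f v)

  _⊗_ : Matrix n → Matrix n → Matrix n
  _⊗_ {n} A B u w = ∑[ v < n ] (A u v * B v w)

  _ᵀ : Matrix n → Matrix n
  (A ᵀ) u v = A v u

  identity : Matrix n
  identity u v = if does (u ≟ᶠ v) then 1# else 0#

  _-[_]I : Matrix n → Carrier → Matrix n
  (A -[ μ ]I) u v = A u v + - (μ * identity u v)

  -- The four Penrose equations, which determine A⁺ uniquely; all entries are
  -- real, so the conjugate transpose is the transpose.
  record IsMoorePenrose (A A⁺ : Matrix n) : Set where
    field
      AA⁺A≋A    : A ⊗ A⁺ ⊗ A ≋ᴹ A
      A⁺AA⁺≋A⁺  : A⁺ ⊗ A ⊗ A⁺ ≋ᴹ A⁺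
      AA⁺-sym   : (A ⊗ A⁺) ᵀ ≋ᴹ A ⊗ A⁺
      A⁺A-sym   : (A⁺ ⊗ A) ᵀ ≋ᴹ A⁺ ⊗ A

  module _ (G : Graph n) where
    open Graph G using (Adj)

    SupportedOn : Pred (Matrix n) 0ℓ
    SupportedOn M = ∀ {u v} → ¬ (M u v ≈ 0#) → u ≢ v → Adj u v

    record IsGeneralizedLaplacian (M : Matrix n) : Set where
      field
        symmetric : M ᵀ ≋ᴹ M
        supported : SupportedOn M
        edge<0    : ∀ {u v} → Adj u v → M u v < 0#

  record IsBasis (E : Pred (Vector Carrier n) 0ℓ) {m : ℕ}
                 (b : Fin m → Vector Carrier n) : Set where
    combination : Vector Carrier m → Vector Carrier n
    combination c v = ∑[ i < m ] (c i * b i v)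

    field
      inside      : ∀ i → E (b i)
      independent : ∀ c → combination c ≋ (λ _ → 0#) → ∀ i → c i ≈ 0#
      spanning    : ∀ f → E f → ∃ λ c → f ≋ combination c

  Dimension : Pred (Vector Carrier n) 0ℓ → ℕ → Set
  Dimension E m = ∃ λ (b : Fin m → _) → IsBasis E b

  Eigenspace : Matrix n → Carrier → Pred (Vector Carrier n) 0ℓ
  Eigenspace M μ f = M · f ≋ λ v → μ * f v

  IsEigenvector : Matrix n → Carrier → Pred (Vector Carrier n) 0ℓ
  IsEigenvector M μ f = ¬ (f ≋ λ _ → 0#) × Eigenspace M μ f

  -- Only used for symmetric M, whose eigenvalues have equal algebraic and
  -- geometric multiplicities.
  Multiplicity : Matrix n → Carrier → ℕ → Set
  Multiplicity M μ m = Dimension (Eigenspace M μ) m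

  IsSimpleEigenvalue : Matrix n → Carrier → Set
  IsSimpleEigenvalue M μ = Multiplicity M μ 1

  -- The entries of ev are the eigenvalues of M in nondecreasing order, each
  -- listed as often as its multiplicity (and non-eigenvalues, of multiplicity
  -- zero, not at all).
  record IsSpectrum (M : Matrix n) (ev : Vector Carrier n) : Set where
    field
      ordered      : ∀ {i j} → i ≤ᶠ j → ev i ≤ ev j
      multiplicity : ∀ μ →
        Multiplicity M μ (length (filter (λ i → ev i ≟ μ) (allFin n)))

  Urschel : Vector Carrier n → Pred (Fin n) 0ℓ
  Urschel f v = f v ≈ 0#

  Shallow : Graph n → Vector Carrier n → Pred (Fin n) 0ℓ
  Shallow G f v = Urschel f v × ∃ λ u → Graph.Adj G v u × ¬ Urschel f u

  -- SND G f m: f has exactly m strong nodal domains.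
  SND : Graph n → Vector Carrier n → ℕ → Set
  SND G f m = ∃₂ λ p q →
    ComponentCount G (λ v → 0# < f v) p ×
    ComponentCount G (λ v → f v < 0#) q ×
    m ≡ p ℕ.+ q

  record IsSigning (f g : Vector Carrier n) : Set where
    field
      nowhereZero : ∀ v → ¬ (g v ≈ 0#)
      onPositive  : ∀ v → 0# < f v → 0# < g v
      onNegative  : ∀ v → f v < 0# → g v < 0#

  -- UNmax G f m: the maximum Urschel number of f is m.
  UNmax : Graph n → Vector Carrier n → ℕ → Set
  UNmax G f m =
    (∃ λ g → IsSigning f g × SND G g m) ×
    (∀ g j → IsSigning f g → SND G g j → j ℕ.≤ m)

{-# OPTIONS --safe #-}
module Submission where

open import Defs
open import Level using (0ℓ)
open import Data.Bool.Base using (Bool; true; false; if_then_else_)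
open import Data.Fin.Base using (Fin; toℕ; zero; suc; _↑ˡ_; _↑ʳ_; punchIn; punchOut; fromℕ<; join; splitAt)
import Data.Fin.Properties as Fin
open import Data.List.Base as List using (List; []; _∷_; allFin; length; filter; cartesianProduct)
import Data.List.Membership.Propositional as List
import Data.List.Membership.Propositional.Properties as List
open import Data.List.Properties using (filter-notAll)
open import Data.List.Relation.Unary.All using (All; []; _∷_)
open import Data.List.Relation.Unary.All.Properties using (all-filter)
open import Data.List.Relation.Unary.Any as Any using (here; there)
open import Data.List.Relation.Unary.Any.Properties using (lookup-index)
open import Data.Nat.Base as ℕ using (ℕ; suc)
import Data.Nat.Properties as ℕ
open import Data.Product.Base using (∃; _×_; _,_; proj₁; proj₂; map₂)
open import Data.Sum.Base using (_⊎_; inj₁; inj₂; [_,_]′; map₁)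
open import Data.Vec.Base as Vec using (Vec; []; _∷_)
open import Data.Vec.Properties using (lookup∘tabulate)
open import Data.Vec.Functional using (Vector; updateAt)
open import Data.Vec.Functional.Properties using (updateAt-updates; updateAt-minimal)
open import Function.Base using (_∘_; id)
open import Function.Bundles using (Bijection)
open import Relation.Binary.Bundles using (Setoid)
open import Relation.Binary.Construct.Closure.ReflexiveTransitive as Star using (Star; ε; _◅_; _◅◅_)
import Relation.Binary.Construct.On as On
open import Relation.Binary.Core using (Rel)
open import Relation.Binary.Definitions using (tri<; tri≈; tri>)
open import Relation.Binary.Structures using (IsStrictTotalOrder)
import Relation.Binary.Definitions as Binary
open import Relation.Binary.PropositionalEquality as ≡ using (_≡_; _≢_; refl)
open import Relation.Nullary.Decidable using (Dec; yes; no; does; ¬?; _×-dec_)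
open import Relation.Nullary.Negation using (¬_; contradiction)
open import Relation.Unary using (Pred; Decidable)

-- A signing g of f has no more than k strong nodal domains because every one of
-- them contains a vertex where f ≠ 0: an Urschel vertex is shallow, so by the
-- eigenvector equation it has neighbours of both signs.  The restrictions of f
-- to the domains of g are thus linearly independent, and, as in Courant's nodal
-- theorem, the form of M - λₖ I is nonpositive on their span.  Since λₖ is
-- simple, that form is positive definite on the span of n - k eigenvectors, and
-- the two subspaces meet in 0.
-- For the first part, f₁ is orthogonal to f, so f₁ = (M - λₖ I)⁺ (M - λₖ I) f₁, and
-- any vector is M₁ f for an M₁ supported on G with one entry per row, in
-- the column of a non-Urschel vertex equal or adjacent to the row index.

-- The first half of the statement suggests a perturbative proof of the bound: move M by a small
-- multiple of a suitable `M₁`, so that the zeros of f acquire prescribed signs, and count the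
-- domains of the perturbed eigenvector. The bound here involves no limit. A signing only decides
-- how the Urschel vertices are attached to the rest, and the form of M - λₖ I at a product x f sees
-- an edge uv only through f u f v, so edges at zeros of f contribute nothing and f itself can be
-- cut along the domains of the signing. Two further points shape the development. The spectrum is
-- given through dimensions of eigenspaces, so a family of orthogonal eigenvectors matching the list
-- `ev` has to be constructed; it stays unnormalised, which avoids square roots. And the maximum in
-- the Urschel number ranges over infinitely many signings: it exists because the number of domains
-- depends on signs alone, which leaves finitely many patterns.

private
  variable
    n : ℕ

-- Components of finite graphs

redirect : Fin n → Fin n → Fin n → Fin n
redirect a b w = if does (w Fin.≟ a) then b else w

redirect-source : ∀ (a b : Fin n) → redirect a b a ≡ b
redirect-source a b with a Fin.≟ a
... | yes _  = refl
... | no a≢a = contradiction refl a≢a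

redirect-target : ∀ (a b : Fin n) → redirect a b b ≡ b
redirect-target a b with b Fin.≟ a
... | yes _ = refl
... | no _  = refl

-- Union-find over a list of edges: an edge from a to b merges the class of a into that of b.
-- Vertices that become equivalent are joined by a walk through this edge, possibly traversed
-- backwards, whence the symmetry of `T`.
representatives : {T : Rel (Fin n) 0ℓ} → Binary.Symmetric T →
                  (es : List (Fin n × Fin n)) → All (λ (a , b) → T a b) es →
                  ∃ λ (rep : Fin n → Fin n) →
                    (∀ u v → rep u ≡ rep v → Star T u v) ×
                    (∀ {u v} → (u , v) List.∈ es → rep u ≡ rep v)
representatives T-sym [] [] = id , (λ { u .u refl → ε }) , λ ()
representatives {n} {T} T-sym ((a , b) ∷ es) (t ∷ ts)
  with rep , sound , complete ← representatives T-sym es ts = rep′ , sound′ , complete′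
  where
  rep′ : Fin n → Fin n
  rep′ = redirect (rep a) (rep b) ∘ rep

  sound′ : ∀ u v → rep′ u ≡ rep′ v → Star T u v
  sound′ u v eq with rep u Fin.≟ rep a | rep v Fin.≟ rep a
  ... | yes u~a | yes v~a = sound u v (≡.trans u~a (≡.sym v~a))
  ... | yes u~a | no _    = sound u a u~a ◅◅ t ◅ sound b v eq
  ... | no _    | yes v~a = sound u b eq ◅◅ T-sym t ◅ sound a v (≡.sym v~a)
  ... | no _    | no _    = sound u v eq

  complete′ : ∀ {u v} → (u , v) List.∈ ((a , b) ∷ es) → rep′ u ≡ rep′ v
  complete′ (here refl)  = ≡.trans (redirect-source (rep a) (rep b)) (≡.sym (redirect-target (rep a) (rep b)))
  complete′ (there uv∈es) = ≡.cong (redirect (rep a) (rep b)) (complete uv∈es)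

subsetSetoid : Pred (Fin n) 0ℓ → Setoid 0ℓ 0ℓ
subsetSetoid {n} P = record { isEquivalence = On.isEquivalence {B = ∃ P} proj₁ ≡.isEquivalence }

enumerate : (P : Pred (Fin n) 0ℓ) → Decidable P →
            ∃ λ p → Bijection (subsetSetoid P) (≡.setoid (Fin p))
enumerate {ℕ.zero} P P? = 0 , record
  { to = λ () ; cong = λ { {()} } ; bijective = (λ { {()} }) , λ () }
enumerate {suc n} P P? with enumerate (P ∘ suc) (P? ∘ suc) | P? zero
... | p , bij | yes p₀ = suc p , record
  { to        = to′
  ; cong      = cong′
  ; bijective = (λ {x} {y} → injective′ {x} {y}) , surjective′
  }
  where
  open Bijection bij

  to′ : ∃ P → Fin (suc p)
  to′ (zero , _)  = zero
  to′ (suc v , q) = suc (to (v , q))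

  cong′ : ∀ {x y} → proj₁ x ≡ proj₁ y → to′ x ≡ to′ y
  cong′ {zero , _}  {zero , _}   _    = refl
  cong′ {suc v , _} {suc .v , _} refl = ≡.cong suc (cong refl)

  injective′ : ∀ {x y} → to′ x ≡ to′ y → proj₁ x ≡ proj₁ y
  injective′ {zero , _}  {zero , _}  _  = refl
  injective′ {suc v , _} {suc w , _} eq = ≡.cong suc (injective (Fin.suc-injective eq))

  surjective′ : ∀ i → ∃ λ x → ∀ {z} → proj₁ z ≡ proj₁ x → to′ z ≡ i
  surjective′ zero    = (zero , p₀) , cong′ {y = zero , p₀}
  surjective′ (suc i) with (v , q) , eq ← surjective i =
    (suc v , q) , λ { {suc .v , _} refl → ≡.cong suc (eq refl) }
... | p , bij | no ¬p₀ = p , record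
  { to        = to′
  ; cong      = cong′
  ; bijective = (λ {x} {y} → injective′ {x} {y}) , surjective′
  }
  where
  open Bijection bij

  to′ : ∃ P → Fin p
  to′ (zero , q)  = contradiction q ¬p₀
  to′ (suc v , q) = to (v , q)

  cong′ : ∀ {x y} → proj₁ x ≡ proj₁ y → to′ x ≡ to′ y
  cong′ {zero , q}  {_}          _    = contradiction q ¬p₀
  cong′ {suc v , _} {suc .v , _} refl = cong refl

  injective′ : ∀ {x y} → to′ x ≡ to′ y → proj₁ x ≡ proj₁ y
  injective′ {zero , q}  {_}         _  = contradiction q ¬p₀
  injective′ {suc _ , _} {zero , q}  _  = contradiction q ¬p₀
  injective′ {suc v , _} {suc w , _} eq = ≡.cong suc (injective eq)

  surjective′ : ∀ i → ∃ λ x → ∀ {z} → proj₁ z ≡ proj₁ x → to′ z ≡ i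
  surjective′ i with (v , q) , eq ← surjective i =
    (suc v , q) , λ { {suc .v , _} refl → eq refl }

module _ (G : Graph n) where
  open Graph G

  componentCount : (P : Pred (Fin n) 0ℓ) → Decidable P → ∃ (ComponentCount G P)
  componentCount P P? = count , record
    { to        = toCount
    ; cong      = λ {x} {y} → cong′ {x} {y}
    ; bijective = (λ {x} {y} eq → sound (proj₁ x) (proj₁ y) (injective eq)) , surjective′
    }
    where
    step? : Decidable (λ ((u , v) : Fin n × Fin n) → InducedStep G P u v)
    step? (u , v) = P? u ×-dec P? v ×-dec adj? u v

    pairs steps : List (Fin n × Fin n)
    pairs = cartesianProduct (allFin n) (allFin n)
    steps = filter step? pairs

    reps = representatives {T = InducedStep G P} (λ (p , q , a) → q , p , sym a)
             steps (all-filter step? pairs)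
    rep = proj₁ reps
    sound = proj₁ (proj₂ reps)

    -- A component is identified with the common value of `rep` on it, so counting components
    -- becomes counting a decidable set of vertices.
    Image : Pred (Fin n) 0ℓ
    Image w = ∃ λ v → P v × rep v ≡ w

    images = enumerate Image (λ w → Fin.any? λ v → P? v ×-dec (rep v Fin.≟ w))
    count = proj₁ images
    open Bijection (proj₂ images)

    toCount : ∃ P → Fin count
    toCount (v , p) = to (rep v , v , p , refl)

    complete : ∀ {u v} → InducedStep G P u v → rep u ≡ rep v
    complete {u} {v} t = proj₂ (proj₂ reps)
      (List.∈-filter⁺ step? (List.∈-cartesianProduct⁺ (List.∈-allFin u) (List.∈-allFin v)) t)

    cong′ : ∀ {x y} → Star (InducedStep G P) (proj₁ x) (proj₁ y) → toCount x ≡ toCount y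
    cong′ walk = cong (Star.fold (λ u v → rep u ≡ rep v) (≡.trans ∘ complete) refl walk)

    surjective′ : ∀ i → ∃ λ x → ∀ {z} → Star (InducedStep G P) (proj₁ z) (proj₁ x) → toCount z ≡ i
    surjective′ i with (w , v , p , rep≡w) , eq ← surjective i =
      (v , p) , λ {z} walk → ≡.trans (cong′ {z} {v , p} walk) (eq rep≡w)

  -- `ComponentCount` is a relation, so the counts of equivalent predicates have to be compared.
  -- Pick a vertex in each component for `P`; if two of them share a component for `Q`, the walk
  -- between them is also a walk for `P`, and they came from the same component.
  componentCount-mono : ∀ {P Q p q} → (∀ {v} → P v → Q v) → (∀ {v} → Q v → P v) →
                        ComponentCount G P p → ComponentCount G Q q → p ℕ.≤ q
  componentCount-mono P⊆Q Q⊆P cP cQ = Fin.injective⇒≤ {f = f} λ {i} {j} eq →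
    ≡.trans (≡.sym (proj₂ (P.strictlySurjective i)))
      (≡.trans (P.cong {v i} {v j} (Star.map (λ (p , q , a) → Q⊆P p , Q⊆P q , a) (Q.injective {w i} {w j} eq)))
               (proj₂ (P.strictlySurjective j)))
    where
    module P = Bijection cP
    module Q = Bijection cQ
    v = λ i → proj₁ (P.strictlySurjective i)
    w = λ i → map₂ P⊆Q (v i)
    f = λ i → Q.to (w i)

-- Patterns are vectors rather than functions so that each is literally of the form b ∷ x: the
-- recursion compares the two halves of the cube without any appeal to extensionality.
maximum : (s : Vec Bool n → ℕ) → ∃ λ t → ∀ t′ → s t′ ℕ.≤ s t
maximum {ℕ.zero} s = [] , λ { [] → ℕ.≤-refl }
maximum {suc n} s with maximum (s ∘ (true ∷_)) | maximum (s ∘ (false ∷_))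
... | t , t-max | t′ , t′-max with ℕ.≤-total (s (true ∷ t)) (s (false ∷ t′))
...   | inj₁ ≤ = false ∷ t′ , λ { (true ∷ x) → ℕ.≤-trans (t-max x) ≤ ; (false ∷ x) → t′-max x }
...   | inj₂ ≥ = true ∷ t , λ { (true ∷ x) → t-max x ; (false ∷ x) → ℕ.≤-trans (t′-max x) ≥ }

module _ (R : Reals) where
  open Reals R hiding (zero; isEquivalence) renaming (refl to ≈-refl; sym to ≈-sym; trans to ≈-trans)
  open OverReals R
  open IsStrictTotalOrder isStrictTotalOrder using (<-respˡ-≈; <-respʳ-≈; irrefl; asym) renaming (trans to <-trans)
  open import Algebra.Properties.Ring ring
    using (-‿distribˡ-*; -‿distribʳ-*; -‿involutive; -0#≈0#; -1*x≈-x; +-inverseˡ-unique; +-inverseʳ-unique; x∙y⁻¹≈ε⇒x≈y)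
  open import Algebra.Properties.Semiring.Sum semiring
    using (sum; sum-syntax; sum-cong-≋; sum-replicate-zero; ∑-distrib-+; ∑-comm; *-distribˡ-sum)
  open import Algebra.Solver.Ring.NaturalCoefficients.Default commutativeSemiring
    using (solve; _:=_; _:+_; _:*_)
  open import Relation.Binary.Reasoning.Setoid setoid

  -- Ordered fields

  <⇒≉ : ∀ {x} → 0# < x → x ≉ 0#
  <⇒≉ 0<x x≈0 = irrefl (≈-sym x≈0) 0<x

  >⇒≉ : ∀ {x} → x < 0# → x ≉ 0#
  >⇒≉ x<0 x≈0 = irrefl x≈0 x<0

  ≉⇒<⊎> : ∀ {x} → x ≉ 0# → 0# < x ⊎ x < 0#
  ≉⇒<⊎> {x} x≉0 with compare 0# x
  ... | tri< 0<x _ _ = inj₁ 0<x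
  ... | tri≈ _ 0≈x _ = contradiction (≈-sym 0≈x) x≉0
  ... | tri> _ _ x<0 = inj₂ x<0

  ≮⇒≥ : ∀ {x} → ¬ (0# < x) → x ≤ 0#
  ≮⇒≥ {x} 0≮x with compare 0# x
  ... | tri< 0<x _ _ = contradiction 0<x 0≮x
  ... | tri≈ _ 0≈x _ = inj₂ (≈-sym 0≈x)
  ... | tri> _ _ x<0 = inj₁ x<0

  ≯⇒≤ : ∀ {x} → ¬ (x < 0#) → 0# ≤ x
  ≯⇒≤ {x} x≮0 with compare 0# x
  ... | tri< 0<x _ _ = inj₁ 0<x
  ... | tri≈ _ 0≈x _ = inj₂ 0≈x
  ... | tri> _ _ x<0 = contradiction x<0 x≮0

  nonneg-nonpos⇒≈0 : ∀ {x} → 0# ≤ x → x ≤ 0# → x ≈ 0#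
  nonneg-nonpos⇒≈0 (inj₁ 0<x) (inj₁ x<0) = contradiction 0<x (asym x<0)
  nonneg-nonpos⇒≈0 (inj₁ _)   (inj₂ x≈0) = x≈0
  nonneg-nonpos⇒≈0 (inj₂ 0≈x) _          = ≈-sym 0≈x

  ≤0⇒≯0 : ∀ {x} → x ≤ 0# → ¬ (0# < x)
  ≤0⇒≯0 x≤0 0<x = <⇒≉ 0<x (nonneg-nonpos⇒≈0 (inj₁ 0<x) x≤0)

  neg-pos : ∀ {x} → x < 0# → 0# < - x
  neg-pos {x} x<0 = <-respˡ-≈ (-‿inverseʳ x) (<-respʳ-≈ (+-identityˡ (- x)) (+-monoˡ (- x) x<0))

  pos-neg : ∀ {x} → 0# < x → - x < 0#
  pos-neg {x} 0<x = <-respˡ-≈ (+-identityˡ (- x)) (<-respʳ-≈ (-‿inverseʳ x) (+-monoˡ (- x) 0<x))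

  neg-nonneg : ∀ {x} → x ≤ 0# → 0# ≤ - x
  neg-nonneg (inj₁ x<0) = inj₁ (neg-pos x<0)
  neg-nonneg (inj₂ x≈0) = inj₂ (≈-sym (≈-trans (-‿cong x≈0) -0#≈0#))

  0≤-resp : ∀ {x y} → x ≈ y → 0# ≤ x → 0# ≤ y
  0≤-resp x≈y (inj₁ 0<x) = inj₁ (<-respʳ-≈ x≈y 0<x)
  0≤-resp x≈y (inj₂ 0≈x) = inj₂ (≈-trans 0≈x x≈y)

  +-pos-nonneg : ∀ {x y} → 0# < x → 0# ≤ y → 0# < x + y
  +-pos-nonneg {x} {y} 0<x 0≤y with <-respˡ-≈ (+-identityˡ y) (+-monoˡ y 0<x) | 0≤y
  ... | y<x+y | inj₁ 0<y = <-trans 0<y y<x+y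
  ... | y<x+y | inj₂ 0≈y = <-respˡ-≈ (≈-sym 0≈y) y<x+y

  +-nonneg : ∀ {x y} → 0# ≤ x → 0# ≤ y → 0# ≤ x + y
  +-nonneg (inj₁ 0<x) 0≤y = inj₁ (+-pos-nonneg 0<x 0≤y)
  +-nonneg (inj₂ 0≈x) 0≤y = 0≤-resp (≈-trans (≈-sym (+-identityˡ _)) (+-congʳ 0≈x)) 0≤y

  +-nonneg-zeroˡ : ∀ {x y} → 0# ≤ x → 0# ≤ y → x + y ≈ 0# → x ≈ 0#
  +-nonneg-zeroˡ (inj₁ 0<x) 0≤y x+y≈0 = contradiction x+y≈0 (<⇒≉ (+-pos-nonneg 0<x 0≤y))
  +-nonneg-zeroˡ (inj₂ 0≈x) 0≤y x+y≈0 = ≈-sym 0≈x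

  +-nonneg-zeroʳ : ∀ {x y} → 0# ≤ x → 0# ≤ y → x + y ≈ 0# → y ≈ 0#
  +-nonneg-zeroʳ 0≤x 0≤y x+y≈0 = +-nonneg-zeroˡ 0≤y 0≤x (≈-trans (+-comm _ _) x+y≈0)

  *-nonneg : ∀ {x y} → 0# ≤ x → 0# ≤ y → 0# ≤ x * y
  *-nonneg (inj₁ 0<x) (inj₁ 0<y) = inj₁ (*-pos 0<x 0<y)
  *-nonneg (inj₂ 0≈x) _          = inj₂ (≈-sym (≈-trans (*-congʳ (≈-sym 0≈x)) (zeroˡ _)))
  *-nonneg (inj₁ _)   (inj₂ 0≈y) = inj₂ (≈-sym (≈-trans (*-congˡ (≈-sym 0≈y)) (zeroʳ _)))

  -x*-y≈x*y : ∀ x y → - x * - y ≈ x * y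
  -x*-y≈x*y x y = begin
    - x * - y    ≈⟨ -‿distribˡ-* x (- y) ⟨
    - (x * - y)  ≈⟨ -‿cong (-‿distribʳ-* x y) ⟨
    - - (x * y)  ≈⟨ -‿involutive (x * y) ⟩
    x * y        ∎

  *-nonpos : ∀ {x y} → x ≤ 0# → y ≤ 0# → 0# ≤ x * y
  *-nonpos x≤0 y≤0 = 0≤-resp (-x*-y≈x*y _ _) (*-nonneg (neg-nonneg x≤0) (neg-nonneg y≤0))

  *-nonpos-nonneg : ∀ {x y} → x ≤ 0# → 0# ≤ y → x * y ≤ 0#
  *-nonpos-nonneg x≤0 0≤y with *-nonneg (neg-nonneg x≤0) 0≤y
  ... | p with 0≤-resp (≈-sym (-‿distribˡ-* _ _)) p
  ...   | inj₁ 0<-xy = inj₁ (<-respˡ-≈ (-‿involutive _) (pos-neg 0<-xy))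
  ...   | inj₂ 0≈-xy = inj₂ (≈-trans (≈-sym (-‿involutive _)) (≈-trans (-‿cong (≈-sym 0≈-xy)) -0#≈0#))

  square-nonneg : ∀ x → 0# ≤ x * x
  square-nonneg x with compare 0# x
  ... | tri< 0<x _ _ = *-nonneg (inj₁ 0<x) (inj₁ 0<x)
  ... | tri≈ _ 0≈x _ = *-nonneg (inj₂ 0≈x) (inj₂ 0≈x)
  ... | tri> _ _ x<0 = *-nonpos (inj₁ x<0) (inj₁ x<0)

  *-cancel-zeroˡ : ∀ {x y} → x ≉ 0# → x * y ≈ 0# → y ≈ 0#
  *-cancel-zeroˡ {x} {y} x≉0 xy≈0 with x⁻¹ , xx⁻¹≈1 ← inverse x x≉0 = begin
    y              ≈⟨ *-identityˡ y ⟨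
    1# * y         ≈⟨ *-congʳ xx⁻¹≈1 ⟨
    x * x⁻¹ * y    ≈⟨ solve 3 (λ a b c → a :* b :* c := b :* (a :* c)) ≈-refl x x⁻¹ y ⟩
    x⁻¹ * (x * y)  ≈⟨ *-congˡ xy≈0 ⟩
    x⁻¹ * 0#       ≈⟨ zeroʳ x⁻¹ ⟩
    0#             ∎

  *-≉0 : ∀ {x y} → x ≉ 0# → y ≉ 0# → x * y ≉ 0#
  *-≉0 x≉0 y≉0 = y≉0 ∘ *-cancel-zeroˡ x≉0

  square-zero : ∀ {x} → x * x ≈ 0# → x ≈ 0#
  square-zero {x} xx≈0 with x ≟ 0#
  ... | yes x≈0 = x≈0
  ... | no x≉0  = *-cancel-zeroˡ x≉0 xx≈0

  -- Sums and inner products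

  sum-zero : (t : Vector Carrier n) → (∀ i → t i ≈ 0#) → sum t ≈ 0#
  sum-zero {n} t t≈0 = ≈-trans (sum-cong-≋ t≈0) (sum-replicate-zero n)

  sum-nonneg : (t : Vector Carrier n) → (∀ i → 0# ≤ t i) → 0# ≤ sum t
  sum-nonneg {ℕ.zero} t 0≤t = inj₂ ≈-refl
  sum-nonneg {suc n}  t 0≤t = +-nonneg (0≤t zero) (sum-nonneg (t ∘ suc) (0≤t ∘ suc))

  sum-nonneg-zero : (t : Vector Carrier n) → (∀ i → 0# ≤ t i) → sum t ≈ 0# → ∀ i → t i ≈ 0#
  sum-nonneg-zero t 0≤t ∑≈0 zero    = +-nonneg-zeroˡ (0≤t zero) (sum-nonneg _ (0≤t ∘ suc)) ∑≈0
  sum-nonneg-zero t 0≤t ∑≈0 (suc i) =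
    sum-nonneg-zero (t ∘ suc) (0≤t ∘ suc) (+-nonneg-zeroʳ (0≤t zero) (sum-nonneg _ (0≤t ∘ suc)) ∑≈0) i

  sum-single : (t : Vector Carrier n) (i : Fin n) → (∀ j → j ≢ i → t j ≈ 0#) → sum t ≈ t i
  sum-single t zero    t≈0 = ≈-trans (+-congˡ (sum-zero _ λ j → t≈0 (suc j) λ ())) (+-identityʳ _)
  sum-single t (suc i) t≈0 = ≈-trans (+-cong (t≈0 zero λ ()) (sum-single (t ∘ suc) i λ j j≢i →
    t≈0 (suc j) (j≢i ∘ Fin.suc-injective))) (+-identityˡ _)

  sum-++ : ∀ m {r} (t : Vector Carrier (m ℕ.+ r)) → sum t ≈ sum (t ∘ (_↑ˡ r)) + sum (t ∘ (m ↑ʳ_))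
  sum-++ ℕ.zero  t = ≈-sym (+-identityˡ _)
  sum-++ (suc m) t = ≈-trans (+-congˡ (sum-++ m (t ∘ suc))) (≈-sym (+-assoc _ _ _))

  infix 8 ⟨_,_⟩
  ⟨_,_⟩ : Vector Carrier n → Vector Carrier n → Carrier
  ⟨_,_⟩ {n} x y = ∑[ v < n ] (x v * y v)

  combination : ∀ {m} → Vector Carrier m → (Fin m → Vector Carrier n) → Vector Carrier n
  combination {m = m} c b v = ∑[ i < m ] (c i * b i v)

  ⟨⟩-cong : ∀ {x x′ y y′ : Vector Carrier n} → x ≋ x′ → y ≋ y′ → ⟨ x , y ⟩ ≈ ⟨ x′ , y′ ⟩
  ⟨⟩-cong x≋x′ y≋y′ = sum-cong-≋ λ v → *-cong (x≋x′ v) (y≋y′ v)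

  ⟨⟩-congʳ : ∀ (x : Vector Carrier n) {y y′} → y ≋ y′ → ⟨ x , y ⟩ ≈ ⟨ x , y′ ⟩
  ⟨⟩-congʳ x = ⟨⟩-cong {x = x} λ _ → ≈-refl

  ⟨⟩-comm : ∀ (x y : Vector Carrier n) → ⟨ x , y ⟩ ≈ ⟨ y , x ⟩
  ⟨⟩-comm x y = sum-cong-≋ λ v → *-comm (x v) (y v)

  ⟨⟩-zeroʳ : ∀ (x : Vector Carrier n) {y} → y ≋ (λ _ → 0#) → ⟨ x , y ⟩ ≈ 0#
  ⟨⟩-zeroʳ x y≋0 = sum-zero _ λ v → ≈-trans (*-congˡ (y≋0 v)) (zeroʳ _)

  ⟨⟩-+ʳ : ∀ (w x y : Vector Carrier n) → ⟨ w , (λ v → x v + y v) ⟩ ≈ ⟨ w , x ⟩ + ⟨ w , y ⟩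
  ⟨⟩-+ʳ w x y = ≈-trans (sum-cong-≋ λ v → distribˡ (w v) (x v) (y v)) (∑-distrib-+ (λ v → w v * x v) (λ v → w v * y v))

  ⟨⟩-*ʳ : ∀ (w : Vector Carrier n) c x → ⟨ w , (λ v → c * x v) ⟩ ≈ c * ⟨ w , x ⟩
  ⟨⟩-*ʳ {n} w c x = begin
    ⟨ w , (λ v → c * x v) ⟩         ≈⟨ sum-cong-≋ (λ v → solve 3 (λ a b d → a :* (b :* d) := b :* (a :* d)) ≈-refl (w v) c (x v)) ⟩
    sum (λ v → c * (w v * x v))     ≈⟨ *-distribˡ-sum {n} c _ ⟨
    c * ⟨ w , x ⟩                   ∎

  ⟨⟩-+ˡ : ∀ (x y w : Vector Carrier n) → ⟨ (λ v → x v + y v) , w ⟩ ≈ ⟨ x , w ⟩ + ⟨ y , w ⟩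
  ⟨⟩-+ˡ x y w = ≈-trans (⟨⟩-comm (λ v → x v + y v) w)
    (≈-trans (⟨⟩-+ʳ w x y) (+-cong (⟨⟩-comm w x) (⟨⟩-comm w y)))

  ⟨⟩-*ˡ : ∀ c (x w : Vector Carrier n) → ⟨ (λ v → c * x v) , w ⟩ ≈ c * ⟨ x , w ⟩
  ⟨⟩-*ˡ c x w = ≈-trans (⟨⟩-comm (λ v → c * x v) w) (≈-trans (⟨⟩-*ʳ w c x) (*-congˡ (⟨⟩-comm w x)))

  ⟨⟩-combination : ∀ {m} (w : Vector Carrier n) c (b : Fin m → Vector Carrier n) →
                   ⟨ w , combination c b ⟩ ≈ ∑[ i < m ] (c i * ⟨ w , b i ⟩)
  ⟨⟩-combination {n} {m} w c b = begin
    ⟨ w , combination c b ⟩                         ≈⟨ sum-cong-≋ (λ v → *-distribˡ-sum {m} (w v) _) ⟩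
    ∑[ v < n ] ∑[ i < m ] (w v * (c i * b i v))     ≈⟨ ∑-comm {n} {m} _ ⟩
    ∑[ i < m ] ∑[ v < n ] (w v * (c i * b i v))     ≈⟨ sum-cong-≋ (λ i → ⟨⟩-*ʳ w (c i) (b i)) ⟩
    ∑[ i < m ] (c i * ⟨ w , b i ⟩)                  ∎

  ⟨⟩-definite : (x : Vector Carrier n) → ⟨ x , x ⟩ ≈ 0# → x ≋ λ _ → 0#
  ⟨⟩-definite x xx≈0 v = square-zero (sum-nonneg-zero _ (λ v → square-nonneg (x v)) xx≈0 v)

  identity-offDiagonal : ∀ {u v : Fin n} → u ≢ v → identity u v ≈ 0#
  identity-offDiagonal {u = u} {v} u≢v with u Fin.≟ v
  ... | yes u≡v = contradiction u≡v u≢v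
  ... | no _    = ≈-refl

  identity-single : (u : Fin n) (x : Vector Carrier n) → (identity · x) u ≈ x u
  identity-single u x = ≈-trans
    (sum-single _ u λ v v≢u → ≈-trans (*-congʳ (identity-offDiagonal (v≢u ∘ ≡.sym))) (zeroˡ (x v)))
    diagonal
    where
    diagonal : identity u u * x u ≈ x u
    diagonal with u Fin.≟ u
    ... | yes _  = *-identityˡ _
    ... | no u≢u = contradiction refl u≢u

  identity-sym : identity {n} ᵀ ≋ᴹ identity
  identity-sym u v with u Fin.≟ v | v Fin.≟ u
  ... | yes _   | yes _   = ≈-refl
  ... | no _    | no _    = ≈-refl
  ... | yes u≡v | no v≢u  = contradiction (≡.sym u≡v) v≢u
  ... | no u≢v  | yes v≡u = contradiction (≡.sym v≡u) u≢v

  self-adjoint : (A : Matrix n) → A ᵀ ≋ᴹ A → ∀ x y → ⟨ A · x , y ⟩ ≈ ⟨ x , A · y ⟩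
  self-adjoint {n} A A-sym x y = begin
    ⟨ A · x , y ⟩                                ≈⟨ ⟨⟩-comm (A · x) y ⟩
    ∑[ u < n ] (y u * ∑[ v < n ] (A u v * x v))  ≈⟨ sum-cong-≋ (λ u → *-distribˡ-sum {n} (y u) _) ⟩
    ∑[ u < n ] ∑[ v < n ] (y u * (A u v * x v))  ≈⟨ ∑-comm {n} {n} _ ⟩
    ∑[ v < n ] ∑[ u < n ] (y u * (A u v * x v))  ≈⟨ sum-cong-≋ (λ v → sum-cong-≋ λ u → ≈-trans (swap u v) (*-congˡ (*-congʳ (A-sym v u)))) ⟩
    ∑[ v < n ] ∑[ u < n ] (x v * (A v u * y u))  ≈⟨ sum-cong-≋ (λ v → *-distribˡ-sum {n} (x v) _) ⟨
    ⟨ x , A · y ⟩                                ∎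
    where
    swap : ∀ u v → y u * (A u v * x v) ≈ x v * (A u v * y u)
    swap u v = solve 3 (λ a b c → a :* (b :* c) := c :* (b :* a)) ≈-refl (y u) (A u v) (x v)

  -- Linear algebra

  -- Gaussian elimination of unknown zero. If its column vanishes, the first unit vector is a
  -- solution; otherwise a pivot row clears the column in the other rows, which leaves one equation
  -- and one unknown fewer. This is the source of every dimension count below.
  kernel : ∀ {n N} → n ℕ.< N → (B : Fin n → Vector Carrier N) →
           ∃ λ c → (∃ λ j → c j ≉ 0#) × (∀ i → ⟨ B i , c ⟩ ≈ 0#)
  kernel {ℕ.zero} {suc N} _ B = (λ _ → 1#) , (zero , <⇒≉ 0<1) , λ ()
  kernel {suc n} {suc N} (ℕ.s≤s n<N) B with Fin.any? (λ i → ¬? (B i zero ≟ 0#))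
  ... | no ¬pivot = c , (zero , <⇒≉ 0<1) , λ i → begin
    B i zero * 1# + ⟨ B i ∘ suc , (λ _ → 0#) ⟩  ≈⟨ +-cong (*-identityʳ _) (⟨⟩-zeroʳ (B i ∘ suc) λ _ → ≈-refl) ⟩
    B i zero + 0#                               ≈⟨ +-identityʳ _ ⟩
    B i zero                                    ≈⟨ noPivot i ⟩
    0#                                          ∎
    where
    c : Vector Carrier (suc N)
    c zero    = 1#
    c (suc _) = 0#

    noPivot : ∀ i → B i zero ≈ 0#
    noPivot i with B i zero ≟ 0#
    ... | yes z = z
    ... | no nz = contradiction (i , nz) ¬pivot
  ... | yes (p , a≉0) = c , (suc (proj₁ c′≉0) , proj₂ c′≉0) , annihilates
    where
    a⁻¹ = proj₁ (inverse (B p zero) a≉0)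
    aa⁻¹≈1 = proj₂ (inverse (B p zero) a≉0)

    w : Vector Carrier (suc n)
    w i = B i zero * a⁻¹

    reduced : Fin n → Vector Carrier N
    reduced k j = B (punchIn p k) (suc j) + (- w (punchIn p k)) * B p (suc j)

    ih = kernel n<N reduced
    c′ = proj₁ ih
    c′≉0 = proj₁ (proj₂ ih)

    t = ⟨ B p ∘ suc , c′ ⟩

    c : Vector Carrier (suc N)
    -- Back-substitution: this value is forced by the pivot row, whose remaining terms add up to
    -- `t`.
    c zero    = - (a⁻¹ * t)
    c (suc j) = c′ j

    row : ∀ i → ⟨ B i , c ⟩ ≈ (- w i) * t + ⟨ B i ∘ suc , c′ ⟩
    row i = +-congʳ (begin
      B i zero * - (a⁻¹ * t)    ≈⟨ -‿distribʳ-* _ _ ⟨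
      - (B i zero * (a⁻¹ * t))  ≈⟨ -‿cong (*-assoc _ _ _) ⟨
      - (w i * t)               ≈⟨ -‿distribˡ-* _ _ ⟩
      (- w i) * t               ∎)

    annihilates : ∀ i → ⟨ B i , c ⟩ ≈ 0#
    annihilates i with p Fin.≟ i
    ... | yes refl = begin
      ⟨ B i , c ⟩      ≈⟨ row i ⟩
      (- w i) * t + t  ≈⟨ +-congʳ (*-congʳ (-‿cong aa⁻¹≈1)) ⟩
      (- 1#) * t + t   ≈⟨ +-congʳ (-‿distribˡ-* _ _) ⟨
      - (1# * t) + t   ≈⟨ +-congʳ (-‿cong (*-identityˡ t)) ⟩
      - t + t          ≈⟨ -‿inverseˡ t ⟩
      0#               ∎
    ... | no p≢i = ≡.subst (λ i → ⟨ B i , c ⟩ ≈ 0#) (Fin.punchIn-punchOut p≢i) (begin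
      ⟨ B i′ , c ⟩                                                  ≈⟨ row i′ ⟩
      (- w i′) * t + ⟨ B i′ ∘ suc , c′ ⟩                            ≈⟨ +-comm _ _ ⟩
      ⟨ B i′ ∘ suc , c′ ⟩ + (- w i′) * t                            ≈⟨ +-congˡ (⟨⟩-*ˡ (- w i′) (B p ∘ suc) c′) ⟨
      ⟨ B i′ ∘ suc , c′ ⟩ + ⟨ (λ j → (- w i′) * B p (suc j)) , c′ ⟩  ≈⟨ ⟨⟩-+ˡ (B i′ ∘ suc) _ c′ ⟨
      ⟨ reduced k , c′ ⟩                                            ≈⟨ proj₂ (proj₂ ih) k ⟩
      0#                                                            ∎)
      where
      k  = punchOut p≢i
      i′ = punchIn p k

  -- The n + 1 columns of A augmented by y satisfy a nontrivial relation by `kernel`. Injectivity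
  -- forces the coefficient of y to be nonzero, and dividing by it solves the system.
  injective⇒surjective : (A : Matrix n) → (∀ x → A · x ≋ (λ _ → 0#) → x ≋ λ _ → 0#) →
                         ∀ y → ∃ λ x → A · x ≋ y
  injective⇒surjective {n} A injective y = (λ v → (- s) * c (suc v)) , λ u → begin
    (A · λ v → (- s) * c (suc v)) u  ≈⟨ ⟨⟩-*ʳ (A u) (- s) (c ∘ suc) ⟩
    (- s) * ⟨ A u , c ∘ suc ⟩        ≈⟨ *-congˡ (+-inverseʳ-unique _ _ (relation u)) ⟩
    (- s) * - (y u * c zero)         ≈⟨ -x*-y≈x*y _ _ ⟩
    s * (y u * c zero)               ≈⟨ solve 3 (λ a b c → a :* (b :* c) := (c :* a) :* b) ≈-refl s (y u) (c zero) ⟩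
    c zero * s * y u                 ≈⟨ *-congʳ (proj₂ (inverse (c zero) c₀≉0)) ⟩
    1# * y u                         ≈⟨ *-identityˡ _ ⟩
    y u                              ∎
    where
    B : Fin n → Vector Carrier (suc n)
    B u zero    = y u
    B u (suc v) = A u v

    solution = kernel (ℕ.n<1+n n) B
    c = proj₁ solution
    relation = proj₂ (proj₂ solution)

    c₀≉0 : c zero ≉ 0#
    c₀≉0 c₀≈0 with proj₁ (proj₂ solution)
    ... | zero  , c≉0 = c≉0 c₀≈0
    ... | suc v , c≉0 = c≉0 (injective (c ∘ suc) (λ u → begin
      ⟨ A u , c ∘ suc ⟩                 ≈⟨ +-identityˡ _ ⟨
      0# + ⟨ A u , c ∘ suc ⟩            ≈⟨ +-congʳ (≈-trans (*-congˡ c₀≈0) (zeroʳ _)) ⟨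
      y u * c zero + ⟨ A u , c ∘ suc ⟩  ≈⟨ relation u ⟩
      0#                                ∎) v)

    s = proj₁ (inverse (c zero) c₀≉0)

  -- If the kernel of a symmetric matrix A is spanned by f, then A restricts to
  -- an automorphism of the orthogonal complement of f, and A⁺ is its inverse,
  -- extended by 0 on f: so A A⁺ and A⁺ A are both the orthogonal projection.
  module Pseudoinverse
    {n : ℕ} (A : Matrix n) (A-sym : A ᵀ ≋ᴹ A) (f : Vector Carrier n) (f≉0 : ¬ (f ≋ λ _ → 0#))
    (Af≈0 : A · f ≋ λ _ → 0#)
    (kernel⊆ : ∀ x → A · x ≋ (λ _ → 0#) → ∃ λ c → x ≋ λ v → c * f v) where

    N : Carrier
    N = ⟨ f , f ⟩

    N≉0 : N ≉ 0#
    N≉0 = f≉0 ∘ ⟨⟩-definite f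

    N⁻¹ : Carrier
    N⁻¹ = proj₁ (inverse N N≉0)

    NN⁻¹≈1 : N * N⁻¹ ≈ 1#
    NN⁻¹≈1 = proj₂ (inverse N N≉0)

    ⟨f,A·⟩≈0 : ∀ x → ⟨ f , A · x ⟩ ≈ 0#
    ⟨f,A·⟩≈0 x = begin
      ⟨ f , A · x ⟩  ≈⟨ self-adjoint A A-sym f x ⟨
      ⟨ A · f , x ⟩  ≈⟨ ⟨⟩-comm (A · f) x ⟩
      ⟨ x , A · f ⟩  ≈⟨ ⟨⟩-zeroʳ x Af≈0 ⟩
      0#             ∎

    orthogonal-kernel : ∀ x → A · x ≋ (λ _ → 0#) → ⟨ f , x ⟩ ≈ 0# → x ≋ λ _ → 0#
    orthogonal-kernel x Ax≈0 fx≈0 v with c , x≈cf ← kernel⊆ x Ax≈0 =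
      ≈-trans (x≈cf v) (≈-trans (*-congʳ c≈0) (zeroˡ _))
      where
      c≈0 : c ≈ 0#
      c≈0 = *-cancel-zeroˡ N≉0 (begin
        N * c                     ≈⟨ *-comm _ _ ⟩
        c * N                     ≈⟨ ⟨⟩-*ʳ f c f ⟨
        ⟨ f , (λ v → c * f v) ⟩   ≈⟨ ⟨⟩-congʳ f x≈cf ⟨
        ⟨ f , x ⟩                 ≈⟨ fx≈0 ⟩
        0#                        ∎)

    -- A rank-one correction that fills in the kernel: it acts as `A` on the complement of `f` and
    -- scales `f` by `N`, so it is injective and its systems can be solved by
    -- `injective⇒surjective`.
    A+ffᵀ : Matrix n
    A+ffᵀ u v = A u v + f u * f v

    A+ffᵀ-apply : ∀ x u → (A+ffᵀ · x) u ≈ (A · x) u + ⟨ f , x ⟩ * f u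
    A+ffᵀ-apply x u = ≈-trans (⟨⟩-+ˡ (A u) (λ v → f u * f v) x)
      (+-congˡ (≈-trans (⟨⟩-*ˡ (f u) f x) (*-comm _ _)))

    ⟨f,A+ffᵀ·⟩ : ∀ x → ⟨ f , A+ffᵀ · x ⟩ ≈ ⟨ f , x ⟩ * N
    ⟨f,A+ffᵀ·⟩ x = begin
      ⟨ f , A+ffᵀ · x ⟩                                     ≈⟨ ⟨⟩-congʳ f (A+ffᵀ-apply x) ⟩
      ⟨ f , (λ u → (A · x) u + ⟨ f , x ⟩ * f u) ⟩           ≈⟨ ⟨⟩-+ʳ f (A · x) _ ⟩
      ⟨ f , A · x ⟩ + ⟨ f , (λ u → ⟨ f , x ⟩ * f u) ⟩       ≈⟨ +-cong (⟨f,A·⟩≈0 x) (⟨⟩-*ʳ f ⟨ f , x ⟩ f) ⟩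
      0# + ⟨ f , x ⟩ * N                                    ≈⟨ +-identityˡ _ ⟩
      ⟨ f , x ⟩ * N                                         ∎

    A+ffᵀ-injective : ∀ x → A+ffᵀ · x ≋ (λ _ → 0#) → x ≋ λ _ → 0#
    A+ffᵀ-injective x Bx≈0 = orthogonal-kernel x Ax≈0 fx≈0
      where
      fx≈0 : ⟨ f , x ⟩ ≈ 0#
      fx≈0 = *-cancel-zeroˡ N≉0 (begin
        N * ⟨ f , x ⟩        ≈⟨ *-comm _ _ ⟩
        ⟨ f , x ⟩ * N        ≈⟨ ⟨f,A+ffᵀ·⟩ x ⟨
        ⟨ f , A+ffᵀ · x ⟩    ≈⟨ ⟨⟩-zeroʳ f Bx≈0 ⟩
        0#                   ∎)

      Ax≈0 : A · x ≋ λ _ → 0#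
      Ax≈0 u = begin
        (A · x) u                    ≈⟨ +-identityʳ _ ⟨
        (A · x) u + 0#               ≈⟨ +-congˡ (≈-trans (*-congʳ fx≈0) (zeroˡ _)) ⟨
        (A · x) u + ⟨ f , x ⟩ * f u  ≈⟨ A+ffᵀ-apply x u ⟨
        (A+ffᵀ · x) u                ≈⟨ Bx≈0 u ⟩
        0#                           ∎

    project : Vector Carrier n → Vector Carrier n
    project y u = y u + (- (⟨ f , y ⟩ * N⁻¹)) * f u

    project-fixed : ∀ y → ⟨ f , y ⟩ ≈ 0# → project y ≋ y
    project-fixed y fy≈0 u = begin
      y u + (- (⟨ f , y ⟩ * N⁻¹)) * f u  ≈⟨ +-congˡ (*-congʳ (-‿cong (≈-trans (*-congʳ fy≈0) (zeroˡ _)))) ⟩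
      y u + (- 0#) * f u                 ≈⟨ +-congˡ (≈-trans (*-congʳ -0#≈0#) (zeroˡ _)) ⟩
      y u + 0#                           ≈⟨ +-identityʳ _ ⟩
      y u                                ∎

    ⟨f,project⟩≈0 : ∀ y → ⟨ f , project y ⟩ ≈ 0#
    ⟨f,project⟩≈0 y = begin
      ⟨ f , project y ⟩                          ≈⟨ ⟨⟩-+ʳ f y _ ⟩
      fy + ⟨ f , (λ u → (- (fy * N⁻¹)) * f u) ⟩  ≈⟨ +-congˡ (⟨⟩-*ʳ f (- (fy * N⁻¹)) f) ⟩
      fy + (- (fy * N⁻¹)) * N                    ≈⟨ +-congˡ (-‿distribˡ-* _ _) ⟨
      fy + - (fy * N⁻¹ * N)                      ≈⟨ +-congˡ (-‿cong (solve 3 (λ a b c → a :* b :* c := a :* (c :* b)) ≈-refl fy N⁻¹ N)) ⟩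
      fy + - (fy * (N * N⁻¹))                    ≈⟨ +-congˡ (-‿cong (≈-trans (*-congˡ NN⁻¹≈1) (*-identityʳ fy))) ⟩
      fy + - fy                                  ≈⟨ -‿inverseʳ fy ⟩
      0#                                         ∎
      where fy = ⟨ f , y ⟩

    A·project : ∀ y → A · project y ≋ A · y
    A·project y u = begin
      (A · project y) u                          ≈⟨ ⟨⟩-+ʳ (A u) y _ ⟩
      (A · y) u + ⟨ A u , (λ v → c * f v) ⟩      ≈⟨ +-congˡ (⟨⟩-*ʳ (A u) c f) ⟩
      (A · y) u + c * (A · f) u                  ≈⟨ +-congˡ (≈-trans (*-congˡ (Af≈0 u)) (zeroʳ c)) ⟩
      (A · y) u + 0#                             ≈⟨ +-identityʳ _ ⟩
      (A · y) u                                  ∎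
      where c = - (⟨ f , y ⟩ * N⁻¹)

    -- Pairing the equation A x + ⟨ f , x ⟩ f = y with f gives ⟨ f , x ⟩ = ⟨ f , y ⟩ / N. Hence A x
    -- is y minus its component along f, and projecting x does not change A x.
    project-preimage : ∀ x y → A+ffᵀ · x ≋ y → A · project x ≋ project y
    project-preimage x y Bx≈y u = begin
      (A · project x) u                       ≈⟨ A·project x u ⟩
      (A · x) u                               ≈⟨ +-identityʳ _ ⟨
      (A · x) u + 0#                          ≈⟨ +-congˡ (zeroˡ (f u)) ⟨
      (A · x) u + 0# * f u                    ≈⟨ +-congˡ (*-congʳ (-‿inverseʳ d)) ⟨
      (A · x) u + (d + - d) * f u             ≈⟨ +-congˡ (distribʳ (f u) d (- d)) ⟩
      (A · x) u + (d * f u + (- d) * f u)     ≈⟨ +-assoc _ _ _ ⟨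
      (A · x) u + d * f u + (- d) * f u       ≈⟨ +-cong (≈-sym (A+ffᵀ-apply x u)) (*-congʳ (-‿cong d≈)) ⟩
      (A+ffᵀ · x) u + (- e) * f u             ≈⟨ +-congʳ (Bx≈y u) ⟩
      project y u                             ∎
      where
      d = ⟨ f , x ⟩
      e = ⟨ f , y ⟩ * N⁻¹

      d≈ : d ≈ e
      d≈ = begin
        d                          ≈⟨ *-identityʳ d ⟨
        d * 1#                     ≈⟨ *-congˡ NN⁻¹≈1 ⟨
        d * (N * N⁻¹)              ≈⟨ *-assoc d N N⁻¹ ⟨
        d * N * N⁻¹                ≈⟨ *-congʳ (⟨f,A+ffᵀ·⟩ x) ⟨
        ⟨ f , A+ffᵀ · x ⟩ * N⁻¹    ≈⟨ *-congʳ (⟨⟩-congʳ f Bx≈y) ⟩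
        e                          ∎

    preimage : ∀ y → ∃ λ x → A · x ≋ project y × ⟨ f , x ⟩ ≈ 0#
    preimage y = project x , project-preimage x y (proj₂ solution) , ⟨f,project⟩≈0 x
      where
      solution = injective⇒surjective A+ffᵀ A+ffᵀ-injective y
      x = proj₁ solution

    unit : Fin n → Vector Carrier n
    unit w u = identity u w

    -- Solutions are determined up to multiples of `f`. Choosing the one orthogonal to `f` in each
    -- column keeps the range of `A⁺` in the complement of `f`, on which both A⁺ A and A⁺ A A⁺
    -- depend.
    A⁺ : Matrix n
    A⁺ u w = proj₁ (preimage (unit w)) u

    A⁺-column : ∀ w → ⟨ f , (λ u → A⁺ u w) ⟩ ≈ 0#
    A⁺-column w = proj₂ (proj₂ (preimage (unit w)))

    projection : Matrix n
    projection u w = project (unit w) u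

    unit-coordinate : ∀ w x → ⟨ x , unit w ⟩ ≈ x w
    unit-coordinate w x = begin
      ⟨ x , unit w ⟩      ≈⟨ ⟨⟩-comm x (unit w) ⟩
      ⟨ unit w , x ⟩      ≈⟨ ⟨⟩-cong {y = x} (identity-sym w) (λ _ → ≈-refl) ⟩
      (identity · x) w    ≈⟨ identity-single w x ⟩
      x w                 ∎

    projection-entry : ∀ u w → projection u w ≈ identity u w + (- (f u * N⁻¹)) * f w
    projection-entry u w = +-congˡ (begin
      (- (⟨ f , unit w ⟩ * N⁻¹)) * f u  ≈⟨ *-congʳ (-‿cong (*-congʳ (unit-coordinate w f))) ⟩
      (- (f w * N⁻¹)) * f u             ≈⟨ -‿distribˡ-* _ _ ⟨
      - (f w * N⁻¹ * f u)               ≈⟨ -‿cong (solve 3 (λ a b c → a :* b :* c := c :* b :* a) ≈-refl (f w) N⁻¹ (f u)) ⟩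
      - (f u * N⁻¹ * f w)               ≈⟨ -‿distribˡ-* _ _ ⟩
      (- (f u * N⁻¹)) * f w             ∎)

    projection-apply : ∀ y → projection · y ≋ project y
    projection-apply y u = begin
      ⟨ projection u , y ⟩                                          ≈⟨ ⟨⟩-cong {y = y} (projection-entry u) (λ _ → ≈-refl) ⟩
      ⟨ (λ w → identity u w + (- (f u * N⁻¹)) * f w) , y ⟩          ≈⟨ ⟨⟩-+ˡ (identity u) _ y ⟩
      (identity · y) u + ⟨ (λ w → (- (f u * N⁻¹)) * f w) , y ⟩      ≈⟨ +-cong (identity-single u y) (⟨⟩-*ˡ (- (f u * N⁻¹)) f y) ⟩
      y u + (- (f u * N⁻¹)) * ⟨ f , y ⟩                             ≈⟨ +-congˡ (-‿distribˡ-* _ _) ⟨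
      y u + - (f u * N⁻¹ * ⟨ f , y ⟩)                               ≈⟨ +-congˡ (-‿cong (solve 3 (λ a b c → a :* b :* c := c :* b :* a) ≈-refl (f u) N⁻¹ ⟨ f , y ⟩)) ⟩
      y u + - (⟨ f , y ⟩ * N⁻¹ * f u)                               ≈⟨ +-congˡ (-‿distribˡ-* _ _) ⟩
      project y u                                                   ∎

    projection-sym : projection ᵀ ≋ᴹ projection
    projection-sym u w = ≈-trans (projection-entry w u) (+-cong (identity-sym u w) (≈-sym (begin
      (- (⟨ f , unit w ⟩ * N⁻¹)) * f u  ≈⟨ *-congʳ (-‿cong (*-congʳ (unit-coordinate w f))) ⟩
      (- (f w * N⁻¹)) * f u             ∎)))

    ⟨f,A⁺·⟩≈0 : ∀ y → ⟨ f , A⁺ · y ⟩ ≈ 0#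
    ⟨f,A⁺·⟩≈0 y = begin
      ⟨ f , A⁺ · y ⟩                                       ≈⟨ ⟨⟩-congʳ f (λ u → sum-cong-≋ λ w → *-comm (A⁺ u w) (y w)) ⟩
      ⟨ f , combination y (λ w u → A⁺ u w) ⟩               ≈⟨ ⟨⟩-combination f y _ ⟩
      ∑[ w < n ] (y w * ⟨ f , (λ u → A⁺ u w) ⟩)            ≈⟨ ⟨⟩-zeroʳ y A⁺-column ⟩
      0#                                                   ∎

    AA⁺≋projection : A ⊗ A⁺ ≋ᴹ projection
    AA⁺≋projection u w = proj₁ (proj₂ (preimage (unit w))) u

    A·A⁺· : ∀ y → A · A⁺ · y ≋ project y
    A·A⁺· y u = begin
      ⟨ A u , A⁺ · y ⟩                               ≈⟨ ⟨⟩-congʳ (A u) (λ u → sum-cong-≋ λ w → *-comm (A⁺ u w) (y w)) ⟩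
      ⟨ A u , combination y (λ w u → A⁺ u w) ⟩       ≈⟨ ⟨⟩-combination (A u) y _ ⟩
      ⟨ y , (A ⊗ A⁺) u ⟩                             ≈⟨ ⟨⟩-congʳ y (AA⁺≋projection u) ⟩
      ⟨ y , projection u ⟩                           ≈⟨ ⟨⟩-comm y (projection u) ⟩
      (projection · y) u                             ≈⟨ projection-apply y u ⟩
      project y u                                    ∎

    -- No symmetry of `A⁺` has been established, so this is not obtained from `A·A⁺·` by
    -- transposing. Instead, both sides are orthogonal to `f` and have the same image A y, and
    -- `orthogonal-kernel` kills their difference.
    A⁺·A· : ∀ y → A⁺ · A · y ≋ project y
    A⁺·A· y v = x∙y⁻¹≈ε⇒x≈y _ _ (difference≈0 v)
      where
      z = A⁺ · A · y

      difference : Vector Carrier n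
      difference v = z v + - project y v

      subtract : ∀ w → ⟨ w , difference ⟩ ≈ ⟨ w , z ⟩ + - ⟨ w , project y ⟩
      subtract w = begin
        ⟨ w , difference ⟩                                    ≈⟨ ⟨⟩-+ʳ w z _ ⟩
        ⟨ w , z ⟩ + ⟨ w , (λ v → - project y v) ⟩             ≈⟨ +-congˡ (⟨⟩-congʳ w λ v → ≈-sym (-1*x≈-x (project y v))) ⟩
        ⟨ w , z ⟩ + ⟨ w , (λ v → (- 1#) * project y v) ⟩      ≈⟨ +-congˡ (⟨⟩-*ʳ w (- 1#) (project y)) ⟩
        ⟨ w , z ⟩ + (- 1#) * ⟨ w , project y ⟩                ≈⟨ +-congˡ (-1*x≈-x _) ⟩
        ⟨ w , z ⟩ + - ⟨ w , project y ⟩                       ∎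

      difference≈0 : difference ≋ λ _ → 0#
      difference≈0 = orthogonal-kernel difference
        (λ u → begin
          (A · difference) u                ≈⟨ subtract (A u) ⟩
          (A · z) u + - (A · project y) u   ≈⟨ +-cong (≈-trans (A·A⁺· (A · y) u) (project-fixed (A · y) (⟨f,A·⟩≈0 y) u)) (-‿cong (A·project y u)) ⟩
          (A · y) u + - (A · y) u           ≈⟨ -‿inverseʳ _ ⟩
          0#                                ∎)
        (begin
          ⟨ f , difference ⟩                ≈⟨ subtract f ⟩
          ⟨ f , z ⟩ + - ⟨ f , project y ⟩   ≈⟨ +-cong (⟨f,A⁺·⟩≈0 (A · y)) (-‿cong (⟨f,project⟩≈0 y)) ⟩
          0# + - 0#                         ≈⟨ -‿inverseʳ 0# ⟩
          0#                                ∎)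

    A⁺A≋projection : A⁺ ⊗ A ≋ᴹ projection
    A⁺A≋projection u w = begin
      ⟨ A⁺ u , (λ v → A v w) ⟩      ≈⟨ ⟨⟩-congʳ (A⁺ u) (λ v → unit-coordinate w (A v)) ⟨
      (A⁺ · A · unit w) u           ≈⟨ A⁺·A· (unit w) u ⟩
      projection u w                ∎

    -- Covers the first two Penrose equations at once, with A A⁺ acting on `A` and A⁺ A acting on
    -- `A⁺`: the columns of both `A` and `A⁺` are orthogonal to `f`.
    projection-⊗ : ∀ {X : Matrix n} Y → X ≋ᴹ projection → (∀ w → ⟨ f , (λ u → Y u w) ⟩ ≈ 0#) → X ⊗ Y ≋ᴹ Y
    projection-⊗ {X} Y X≋P fY≈0 u w = begin
      ⟨ X u , (λ v → Y v w) ⟩           ≈⟨ ⟨⟩-cong {y = λ v → Y v w} (X≋P u) (λ _ → ≈-refl) ⟩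
      (projection · λ v → Y v w) u      ≈⟨ projection-apply _ u ⟩
      project (λ v → Y v w) u           ≈⟨ project-fixed _ (fY≈0 w) u ⟩
      Y u w                             ∎

    isMoorePenrose : IsMoorePenrose A A⁺
    isMoorePenrose = record
      { AA⁺A≋A   = projection-⊗ A AA⁺≋projection λ w → ≈-trans (⟨⟩-congʳ f (λ v → ≈-sym (unit-coordinate w (A v)))) (⟨f,A·⟩≈0 (unit w))
      ; A⁺AA⁺≋A⁺ = projection-⊗ A⁺ A⁺A≋projection A⁺-column
      ; AA⁺-sym  = λ u w → ≈-trans (AA⁺≋projection w u) (≈-trans (projection-sym u w) (≈-sym (AA⁺≋projection u w)))
      ; A⁺A-sym  = λ u w → ≈-trans (A⁺A≋projection w u) (≈-trans (projection-sym u w) (≈-sym (A⁺A≋projection u w)))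
      }

  -- Spectral theory

  ·-cong : ∀ (A : Matrix n) {x y} → x ≋ y → A · x ≋ A · y
  ·-cong A x≋y u = ⟨⟩-congʳ (A u) x≋y

  shift-apply : ∀ (M : Matrix n) μ x u → ((M -[ μ ]I) · x) u ≈ (M · x) u + - (μ * x u)
  shift-apply M μ x u = begin
    ((M -[ μ ]I) · x) u                                         ≈⟨ ⟨⟩-+ˡ (M u) _ x ⟩
    (M · x) u + ⟨ (λ v → - (μ * identity u v)) , x ⟩            ≈⟨ +-congˡ (⟨⟩-cong {y = x} (λ v → -‿distribˡ-* _ _) λ _ → ≈-refl) ⟩
    (M · x) u + ⟨ (λ v → (- μ) * identity u v) , x ⟩            ≈⟨ +-congˡ (⟨⟩-*ˡ (- μ) (identity u) x) ⟩
    (M · x) u + (- μ) * (identity · x) u                        ≈⟨ +-congˡ (*-congˡ (identity-single u x)) ⟩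
    (M · x) u + (- μ) * x u                                     ≈⟨ +-congˡ (-‿distribˡ-* _ _) ⟨
    (M · x) u + - (μ * x u)                                     ∎

  shift-sym : (M : Matrix n) → M ᵀ ≋ᴹ M → ∀ μ → (M -[ μ ]I) ᵀ ≋ᴹ M -[ μ ]I
  shift-sym M M-sym μ u v = +-cong (M-sym u v) (-‿cong (*-congˡ (identity-sym u v)))

  shift-eigenvector : ∀ (M : Matrix n) μ {ν x} → Eigenspace M ν x →
                      (M -[ μ ]I) · x ≋ λ v → (ν + - μ) * x v
  shift-eigenvector M μ {ν} {x} Mx≈νx u = begin
    ((M -[ μ ]I) · x) u      ≈⟨ shift-apply M μ x u ⟩
    (M · x) u + - (μ * x u)  ≈⟨ +-cong (Mx≈νx u) (-‿distribˡ-* μ (x u)) ⟩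
    ν * x u + (- μ) * x u    ≈⟨ distribʳ (x u) ν (- μ) ⟨
    (ν + - μ) * x u          ∎

  Eigenspace⇒kernel : ∀ (M : Matrix n) μ {x} → Eigenspace M μ x → (M -[ μ ]I) · x ≋ λ _ → 0#
  Eigenspace⇒kernel M μ {x} Mx≈μx u = ≈-trans (shift-eigenvector M μ Mx≈μx u)
    (≈-trans (*-congʳ (-‿inverseʳ μ)) (zeroˡ (x u)))

  kernel⇒Eigenspace : ∀ (M : Matrix n) μ {x} → (M -[ μ ]I) · x ≋ (λ _ → 0#) → Eigenspace M μ x
  kernel⇒Eigenspace M μ {x} Ax≈0 u = x∙y⁻¹≈ε⇒x≈y _ _ (≈-trans (≈-sym (shift-apply M μ x u)) (Ax≈0 u))

  Eigenspace-resp : ∀ (M : Matrix n) {μ ν x} → μ ≈ ν → Eigenspace M μ x → Eigenspace M ν x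
  Eigenspace-resp M μ≈ν Mx≈μx u = ≈-trans (Mx≈μx u) (*-congʳ μ≈ν)

  ·-combination : ∀ {m} (A : Matrix n) c (b : Fin m → Vector Carrier n) →
                  A · combination c b ≋ combination c (λ i → A · b i)
  ·-combination A c b u = ⟨⟩-combination (A u) c b

  combination-eigen : ∀ {m} (A : Matrix n) (ν : Vector Carrier m) (b : Fin m → Vector Carrier n) →
                      (∀ i → Eigenspace A (ν i) (b i)) →
                      ∀ c → A · combination c b ≋ combination (λ i → ν i * c i) b
  combination-eigen A ν b Ab≈νb c u = ≈-trans (·-combination A c b u) (sum-cong-≋ λ i →
    ≈-trans (*-congˡ (Ab≈νb i u))
      (solve 3 (λ a b d → a :* (b :* d) := b :* a :* d) ≈-refl (c i) (ν i) (b i u)))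

  Eigenspace-combination : ∀ {m} (M : Matrix n) μ (b : Fin m → Vector Carrier n) →
                           (∀ i → Eigenspace M μ (b i)) → ∀ c → Eigenspace M μ (combination c b)
  Eigenspace-combination {m = m} M μ b Mb≈μb c u = begin
    (M · combination c b) u                   ≈⟨ combination-eigen M (λ _ → μ) b Mb≈μb c u ⟩
    ∑[ i < m ] (μ * c i * b i u)              ≈⟨ sum-cong-≋ (λ i → *-assoc μ (c i) (b i u)) ⟩
    ∑[ i < m ] (μ * (c i * b i u))            ≈⟨ *-distribˡ-sum {m} μ _ ⟨
    μ * combination c b u                     ∎

  eigenvectors-orthogonal : (M : Matrix n) → M ᵀ ≋ᴹ M → ∀ {μ ν x y} → μ ≉ ν →
                            Eigenspace M μ x → Eigenspace M ν y → ⟨ x , y ⟩ ≈ 0#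
  eigenvectors-orthogonal M M-sym {μ} {ν} {x} {y} μ≉ν Mx≈μx My≈νy =
    *-cancel-zeroˡ (μ≉ν ∘ x∙y⁻¹≈ε⇒x≈y μ ν) (begin
      (μ + - ν) * ⟨ x , y ⟩             ≈⟨ distribʳ _ _ _ ⟩
      μ * ⟨ x , y ⟩ + (- ν) * ⟨ x , y ⟩  ≈⟨ +-congˡ (-‿distribˡ-* _ _) ⟨
      μ * ⟨ x , y ⟩ + - (ν * ⟨ x , y ⟩)  ≈⟨ +-cong (⟨⟩-*ˡ μ x y) (-‿cong (⟨⟩-*ʳ x ν y)) ⟨
      ⟨ (λ v → μ * x v) , y ⟩ + - ⟨ x , (λ v → ν * y v) ⟩  ≈⟨ +-cong (⟨⟩-cong {y = y} Mx≈μx λ _ → ≈-refl) (-‿cong (⟨⟩-congʳ x My≈νy)) ⟨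
      ⟨ M · x , y ⟩ + - ⟨ x , M · y ⟩   ≈⟨ +-congʳ (self-adjoint M M-sym x y) ⟩
      ⟨ x , M · y ⟩ + - ⟨ x , M · y ⟩   ≈⟨ -‿inverseʳ _ ⟩
      0#                                ∎)

  module Spectrum
    {n : ℕ} (M : Matrix n) (M-sym : M ᵀ ≋ᴹ M) (ev : Vector Carrier n) (isSpectrum : IsSpectrum M ev) where

    open IsSpectrum isSpectrum

    -- At every stage the family is indexed by all of `Fin n`, with conditions only on indices below
    -- `l`. All stages then share one index type, and a new vector simply overwrites a placeholder.
    record OrthogonalEigenvectors (l : ℕ) : Set where
      field
        vector     : Fin n → Vector Carrier n
        eigen      : ∀ i → toℕ i ℕ.< l → Eigenspace M (ev i) (vector i)
        nonzero    : ∀ i → toℕ i ℕ.< l → ¬ (vector i ≋ λ _ → 0#)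
        orthogonal : ∀ i j → toℕ i ℕ.< l → toℕ j ℕ.< l → i ≢ j → ⟨ vector i , vector j ⟩ ≈ 0#

    -- Only the earlier eigenvectors for the eigenvalue ev i itself matter, and
    -- there are fewer of them than the multiplicity of ev i.
    next : ∀ i (b : Fin n → Vector Carrier n) → (∀ j → toℕ j ℕ.< toℕ i → Eigenspace M (ev j) (b j)) →
           ∃ λ x → Eigenspace M (ev i) x × ¬ (x ≋ λ _ → 0#) × (∀ j → toℕ j ℕ.< toℕ i → ⟨ b j , x ⟩ ≈ 0#)
    next i b b-eigen = x , Eigenspace-combination M (ev i) basis inside c , x≉0 , orthogonal
      where
      equal = filter (λ j → ev j ≟ ev i) (allFin n)
      earlier? : ∀ (j : Fin n) → Dec (toℕ j ℕ.< toℕ i)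
      earlier? j = toℕ j ℕ.<? toℕ i
      earlier = filter earlier? equal

      -- The spectrum states this multiplicity as the length of `equal`, so the basis offers that
      -- many unknown coefficients against `length earlier` orthogonality conditions.
      basis = proj₁ (multiplicity (ev i))
      open IsBasis (proj₂ (multiplicity (ev i))) using (inside; independent)

      i∈equal : i List.∈ equal
      i∈equal = List.∈-filter⁺ (λ j → ev j ≟ ev i) (List.∈-allFin i) ≈-refl

      fewer : length earlier ℕ.< length equal
      fewer = filter-notAll earlier? equal (Any.map (λ { refl → ℕ.<-irrefl refl }) i∈equal)

      rows : Fin (length earlier) → Vector Carrier (length equal)
      rows r t = ⟨ b (List.lookup earlier r) , basis t ⟩

      solution = kernel fewer rows
      c = proj₁ solution
      x = combination c basis

      x≉0 : ¬ (x ≋ λ _ → 0#)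
      x≉0 x≈0 = proj₂ (proj₁ (proj₂ solution)) (independent c x≈0 _)

      rows-orthogonal : ∀ r → ⟨ b (List.lookup earlier r) , x ⟩ ≈ 0#
      rows-orthogonal r = begin
        ⟨ b (List.lookup earlier r) , x ⟩  ≈⟨ ⟨⟩-combination _ c basis ⟩
        ⟨ c , rows r ⟩                     ≈⟨ ⟨⟩-comm c (rows r) ⟩
        ⟨ rows r , c ⟩                     ≈⟨ proj₂ (proj₂ solution) r ⟩
        0#                                 ∎

      orthogonal : ∀ j → toℕ j ℕ.< toℕ i → ⟨ b j , x ⟩ ≈ 0#
      orthogonal j j<i = decide (ev j ≟ ev i)
        where
        decide : Dec (ev j ≈ ev i) → ⟨ b j , x ⟩ ≈ 0#
        decide (yes ev≈) = ≡.subst (λ k → ⟨ b k , x ⟩ ≈ 0#) (≡.sym (lookup-index j∈earlier)) (rows-orthogonal (Any.index j∈earlier))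
          where
          j∈earlier : j List.∈ earlier
          j∈earlier = List.∈-filter⁺ earlier? (List.∈-filter⁺ (λ j → ev j ≟ ev i) (List.∈-allFin j) ev≈) j<i
        decide (no ev≉) = eigenvectors-orthogonal M M-sym ev≉ (b-eigen j j<i)
          (Eigenspace-combination M (ev i) basis inside c)

    extend : ∀ l → l ℕ.< n → OrthogonalEigenvectors l → OrthogonalEigenvectors (suc l)
    extend l l<n os = record
      { vector     = b
      ; eigen      = λ j j≤l → proj₁ (good j j≤l)
      ; nonzero    = λ j j≤l → proj₂ (good j j≤l)
      ; orthogonal = λ j k j≤l k≤l → orth j k (split j j≤l) (split k k≤l)
      }
      where
      module O = OrthogonalEigenvectors os
      i : Fin n
      i = fromℕ< l<n

      i≡l : toℕ i ≡ l
      i≡l = Fin.toℕ-fromℕ< l<n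

      below : ∀ {j : Fin n} → toℕ j ℕ.< toℕ i → toℕ j ℕ.< l
      below = ≡.subst (_ ℕ.<_) i≡l

      new = next i O.vector (λ j j<i → O.eigen j (below j<i))
      x = proj₁ new

      b : Fin n → Vector Carrier n
      b = updateAt O.vector i λ _ → x

      bi≡x : b i ≡ x
      bi≡x = updateAt-updates i O.vector

      split : ∀ j → toℕ j ℕ.< suc l → j ≡ i ⊎ (toℕ j ℕ.< l × b j ≡ O.vector j)
      split j j≤l with j Fin.≟ i
      ... | yes j≡i = inj₁ j≡i
      ... | no j≢i  = inj₂ ( ℕ.≤∧≢⇒< (ℕ.s≤s⁻¹ j≤l) (λ j≡l → j≢i (Fin.toℕ-injective (≡.trans j≡l (≡.sym i≡l))))
                           , updateAt-minimal j i O.vector j≢i)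

      good : ∀ j → toℕ j ℕ.< suc l → Eigenspace M (ev j) (b j) × ¬ (b j ≋ λ _ → 0#)
      good j j≤l with split j j≤l
      ... | inj₁ refl       rewrite bi≡x = proj₁ (proj₂ new) , proj₁ (proj₂ (proj₂ new))
      ... | inj₂ (j<l , bj) rewrite bj   = O.eigen j j<l , O.nonzero j j<l

      new-orthogonal : ∀ j → toℕ j ℕ.< l → b j ≡ O.vector j → ⟨ b j , b i ⟩ ≈ 0#
      new-orthogonal j j<l bj rewrite bj | bi≡x = proj₂ (proj₂ (proj₂ new)) j (≡.subst (toℕ j ℕ.<_) (≡.sym i≡l) j<l)

      orth : ∀ j k → j ≡ i ⊎ (toℕ j ℕ.< l × b j ≡ O.vector j) → k ≡ i ⊎ (toℕ k ℕ.< l × b k ≡ O.vector k) →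
             j ≢ k → ⟨ b j , b k ⟩ ≈ 0#
      orth j k (inj₁ refl)       (inj₁ refl)       j≢k = contradiction refl j≢k
      orth j k (inj₁ refl)       (inj₂ (k<l , bk)) _   = ≈-trans (⟨⟩-comm (b i) (b k)) (new-orthogonal k k<l bk)
      orth j k (inj₂ (j<l , bj)) (inj₁ refl)       _   = new-orthogonal j j<l bj
      orth j k (inj₂ (j<l , bj)) (inj₂ (k<l , bk)) j≢k rewrite bj | bk = O.orthogonal j k j<l k<l j≢k

    orthogonalEigenvectors : ∀ l → l ℕ.≤ n → OrthogonalEigenvectors l
    orthogonalEigenvectors ℕ.zero  _   = record
      { vector = λ _ _ → 0# ; eigen = λ _ () ; nonzero = λ _ () ; orthogonal = λ _ _ () }
    orthogonalEigenvectors (suc l) l<n = extend l l<n (orthogonalEigenvectors l (ℕ.<⇒≤ l<n))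

  -- Subspaces on which the form of A is positive definite and nonpositive,
  -- respectively, meet only in 0.
  module Inertia
    {n r m : ℕ} (A : Matrix n) (A-sym : A ᵀ ≋ᴹ A)
    (ν : Vector Carrier r) (0<ν : ∀ j → 0# < ν j) (e : Fin r → Vector Carrier n)
    (e-eigen : ∀ j → Eigenspace A (ν j) (e j)) (e≉0 : ∀ j → ¬ (e j ≋ λ _ → 0#))
    (e-orthogonal : ∀ i j → i ≢ j → ⟨ e i , e j ⟩ ≈ 0#)
    (h : Fin m → Vector Carrier n)
    (h-independent : ∀ c → combination c h ≋ (λ _ → 0#) → ∀ i → c i ≈ 0#)
    (h-nonpositive : ∀ c → ⟨ combination c h , A · combination c h ⟩ ≤ 0#) where

    form-positive : ∀ c → ⟨ combination c e , A · combination c e ⟩ ≈ ∑[ j < r ] (ν j * ⟨ e j , e j ⟩ * (c j * c j))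
    form-positive c = begin
      ⟨ y , A · y ⟩                                  ≈⟨ self-adjoint A A-sym y y ⟨
      ⟨ A · y , y ⟩                                  ≈⟨ ⟨⟩-combination (A · y) c e ⟩
      ∑[ j < r ] (c j * ⟨ A · y , e j ⟩)             ≈⟨ sum-cong-≋ (λ j → *-congˡ (coefficient j)) ⟩
      ∑[ j < r ] (c j * (ν j * (c j * ⟨ e j , e j ⟩)))  ≈⟨ sum-cong-≋ (λ j → solve 3 (λ a b d → a :* (b :* (a :* d)) := b :* d :* (a :* a)) ≈-refl (c j) (ν j) ⟨ e j , e j ⟩) ⟩
      ∑[ j < r ] (ν j * ⟨ e j , e j ⟩ * (c j * c j))    ∎
      where
      y = combination c e

      coefficient : ∀ j → ⟨ A · y , e j ⟩ ≈ ν j * (c j * ⟨ e j , e j ⟩)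
      coefficient j = begin
        ⟨ A · y , e j ⟩                   ≈⟨ self-adjoint A A-sym y (e j) ⟩
        ⟨ y , A · e j ⟩                   ≈⟨ ⟨⟩-congʳ y (e-eigen j) ⟩
        ⟨ y , (λ v → ν j * e j v) ⟩       ≈⟨ ⟨⟩-*ʳ y (ν j) (e j) ⟩
        ν j * ⟨ y , e j ⟩                 ≈⟨ *-congˡ (⟨⟩-comm y (e j)) ⟩
        ν j * ⟨ e j , y ⟩                 ≈⟨ *-congˡ (⟨⟩-combination (e j) c e) ⟩
        ν j * ∑[ i < r ] (c i * ⟨ e j , e i ⟩)  ≈⟨ *-congˡ (sum-single _ j λ i i≢j → ≈-trans (*-congˡ (e-orthogonal j i (i≢j ∘ ≡.sym))) (zeroʳ (c i))) ⟩
        ν j * (c j * ⟨ e j , e j ⟩)       ∎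

    disjoint : ∀ c d → (∀ v → combination c h v + combination d e v ≈ 0#) →
               (∀ i → c i ≈ 0#) × (∀ j → d j ≈ 0#)
    disjoint c d x+y≈0 = h-independent c x≈0 , d≈0
      where
      x = combination c h
      y = combination d e

      x≈-y : x ≋ λ v → (- 1#) * y v
      x≈-y v = ≈-trans (+-inverseˡ-unique _ _ (x+y≈0 v)) (≈-sym (-1*x≈-x (y v)))

      forms-equal : ⟨ x , A · x ⟩ ≈ ⟨ y , A · y ⟩
      forms-equal = begin
        ⟨ x , A · x ⟩                                      ≈⟨ ⟨⟩-cong x≈-y (λ u → ≈-trans (·-cong A x≈-y u) (⟨⟩-*ʳ (A u) (- 1#) y)) ⟩
        ⟨ (λ v → (- 1#) * y v) , (λ u → (- 1#) * (A · y) u) ⟩  ≈⟨ ⟨⟩-*ˡ (- 1#) y _ ⟩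
        (- 1#) * ⟨ y , (λ u → (- 1#) * (A · y) u) ⟩        ≈⟨ *-congˡ (⟨⟩-*ʳ y (- 1#) (A · y)) ⟩
        (- 1#) * ((- 1#) * ⟨ y , A · y ⟩)                  ≈⟨ *-assoc _ _ _ ⟨
        (- 1#) * (- 1#) * ⟨ y , A · y ⟩                    ≈⟨ *-congʳ (≈-trans (-x*-y≈x*y 1# 1#) (*-identityˡ 1#)) ⟩
        1# * ⟨ y , A · y ⟩                                 ≈⟨ *-identityˡ _ ⟩
        ⟨ y , A · y ⟩                                      ∎

      terms : Vector Carrier r
      terms j = ν j * ⟨ e j , e j ⟩ * (d j * d j)

      terms≥0 : ∀ j → 0# ≤ terms j
      terms≥0 j = *-nonneg (*-nonneg (inj₁ (0<ν j)) (sum-nonneg _ λ v → square-nonneg (e j v))) (square-nonneg (d j))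

      ∑terms≤0 : sum terms ≤ 0#
      ∑terms≤0 = ≮⇒≥ λ 0<∑ → ≤0⇒≯0 (h-nonpositive c)
        (<-respʳ-≈ (≈-trans (≈-sym (form-positive d)) (≈-sym forms-equal)) 0<∑)

      d≈0 : ∀ j → d j ≈ 0#
      d≈0 j = square-zero (*-cancel-zeroˡ (*-≉0 (<⇒≉ (0<ν j)) (e≉0 j ∘ ⟨⟩-definite (e j)))
        (sum-nonneg-zero terms terms≥0 (nonneg-nonpos⇒≈0 (sum-nonneg terms terms≥0) ∑terms≤0) j))

      x≈0 : x ≋ λ _ → 0#
      x≈0 v = ≈-trans (x≈-y v) (≈-trans (*-congˡ (sum-zero _ λ j → ≈-trans (*-congʳ (d≈0 j)) (zeroˡ (e j v)))) (zeroʳ _))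

    -- More than n vectors in n coordinates would have a nontrivial relation by `kernel`, with one
    -- equation per coordinate; `disjoint` shows that all its coefficients vanish.
    dimensions : m ℕ.+ r ℕ.≤ n
    dimensions = ℕ.≮⇒≥ λ n<m+r → dependent (kernel n<m+r family)
      where
      family : Fin n → Vector Carrier (m ℕ.+ r)
      family v t = [ (λ i → h i v) , (λ j → e j v) ]′ (splitAt m t)

      dependent : ¬ (∃ λ c → (∃ λ t → c t ≉ 0#) × (∀ v → ⟨ family v , c ⟩ ≈ 0#))
      dependent (c , (t , ct≉0) , relation) = ct≉0 (≡.subst (λ t → c t ≈ 0#) (Fin.join-splitAt m r t) (vanishes (splitAt m t)))
        where
        c₁ = λ i → c (i ↑ˡ r)
        c₂ = λ j → c (m ↑ʳ j)

        leftPart : ∀ v i → family v (i ↑ˡ r) * c₁ i ≈ c₁ i * h i v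
        leftPart v i rewrite Fin.splitAt-↑ˡ m i r = *-comm _ _

        rightPart : ∀ v j → family v (m ↑ʳ j) * c₂ j ≈ c₂ j * e j v
        rightPart v j rewrite Fin.splitAt-↑ʳ m r j = *-comm _ _

        zeros = disjoint c₁ c₂ λ v → begin
          combination c₁ h v + combination c₂ e v  ≈⟨ +-cong (sum-cong-≋ (leftPart v)) (sum-cong-≋ (rightPart v)) ⟨
          _                                        ≈⟨ sum-++ m _ ⟨
          ⟨ family v , c ⟩                         ≈⟨ relation v ⟩
          0#                                       ∎

        vanishes : ∀ s → c (join m r s) ≈ 0#
        vanishes (inj₁ i) = proj₁ zeros i
        vanishes (inj₂ j) = proj₂ zeros j

  -- Nodal domains

  module Nodal {n : ℕ} (G : Graph n) where
    open Graph G using (Adj; adj?) renaming (sym to adj-sym; irrefl to adj-irrefl)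

    adj⇒≢ : ∀ {u v} → Adj u v → u ≢ v
    adj⇒≢ a u≡v = adj-irrefl u≡v a

    shift-offDiagonal : ∀ (M : Matrix n) μ {u v} → u ≢ v → (M -[ μ ]I) u v ≈ M u v
    shift-offDiagonal M μ {u} {v} u≢v = begin
      M u v + - (μ * identity u v)  ≈⟨ +-congˡ (-‿cong (≈-trans (*-congˡ (identity-offDiagonal u≢v)) (zeroʳ μ))) ⟩
      M u v + - 0#                  ≈⟨ +-congˡ -0#≈0# ⟩
      M u v + 0#                    ≈⟨ +-identityʳ _ ⟩
      M u v                         ∎

    shift-isGeneralizedLaplacian : ∀ {M} → IsGeneralizedLaplacian G M → ∀ μ → IsGeneralizedLaplacian G (M -[ μ ]I)
    shift-isGeneralizedLaplacian {M} L μ = record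
      { symmetric = shift-sym M symmetric μ
      ; supported = λ A≉0 u≢v → supported (λ M≈0 → A≉0 (≈-trans (shift-offDiagonal M μ u≢v) M≈0)) u≢v
      ; edge<0    = λ a → <-respˡ-≈ (≈-sym (shift-offDiagonal M μ (adj⇒≢ a))) (edge<0 a)
      }
      where open IsGeneralizedLaplacian L

    module _ {A : Matrix n} (L : IsGeneralizedLaplacian G A) where
      open IsGeneralizedLaplacian L

      nonadjacent≈0 : ∀ {u v} → u ≢ v → ¬ Adj u v → A u v ≈ 0#
      nonadjacent≈0 {u} {v} u≢v ¬a with A u v ≟ 0#
      ... | yes A≈0 = A≈0
      ... | no A≉0  = contradiction (supported A≉0 u≢v) ¬a

      -- In row v of A f = 0 the diagonal term vanishes with f v. Without a positive neighbour all
      -- other terms would be nonnegative, hence zero, yet the term of the given neighbour u is not.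
      positive-neighbour : ∀ f v → (A · f) v ≈ 0# → f v ≈ 0# → (∃ λ u → Adj v u × f u ≉ 0#) →
                           ∃ λ w → Adj v w × 0# < f w
      positive-neighbour f v Af≈0 fv≈0 (u , v~u , fu≉0) with Fin.any? (λ w → adj? v w ×-dec (0# <? f w))
      ... | yes found = found
      ... | no none   = contradiction (sum-nonneg-zero _ terms≥0 Af≈0 u) (*-≉0 (>⇒≉ (edge<0 v~u)) fu≉0)
        where
        terms≥0 : ∀ w → 0# ≤ A v w * f w
        terms≥0 w with v Fin.≟ w
        ... | yes refl = inj₂ (≈-sym (≈-trans (*-congˡ fv≈0) (zeroʳ _)))
        ... | no v≢w with adj? v w
        ...   | yes v~w = *-nonpos (inj₁ (edge<0 v~w)) (≮⇒≥ λ 0<fw → none (w , v~w , 0<fw))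
        ...   | no v≁w  = inj₂ (≈-sym (≈-trans (*-congʳ (nonadjacent≈0 v≢w v≁w)) (zeroˡ _)))

      negative-neighbour : ∀ f v → (A · f) v ≈ 0# → f v ≈ 0# → (∃ λ u → Adj v u × f u ≉ 0#) →
                           ∃ λ w → Adj v w × f w < 0#
      negative-neighbour f v Af≈0 fv≈0 (u , v~u , fu≉0) =
        map₂ (λ {w} (v~w , 0<-fw) → v~w , <-respˡ-≈ (-‿involutive (f w)) (pos-neg (<-respʳ-≈ (-1*x≈-x (f w)) 0<-fw)))
          (positive-neighbour (λ v → (- 1#) * f v) v
            (≈-trans (⟨⟩-*ʳ (A v) (- 1#) f) (≈-trans (*-congˡ Af≈0) (zeroʳ _)))
            (≈-trans (*-congˡ fv≈0) (zeroʳ _))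
            (u , v~u , fu≉0 ∘ *-cancel-zeroˡ (>⇒≉ (pos-neg 0<1))))

      ∑∑ : (Fin n → Fin n → Carrier) → Carrier
      ∑∑ t = ∑[ u < n ] ∑[ v < n ] t u v

      ∑∑-cong : ∀ {s t} → (∀ u v → s u v ≈ t u v) → ∑∑ s ≈ ∑∑ t
      ∑∑-cong s≈t = sum-cong-≋ λ u → sum-cong-≋ λ v → s≈t u v

      ∑∑-+ : ∀ s t → ∑∑ (λ u v → s u v + t u v) ≈ ∑∑ s + ∑∑ t
      ∑∑-+ s t = ≈-trans (sum-cong-≋ λ u → ∑-distrib-+ (s u) (t u)) (∑-distrib-+ (λ u → sum (s u)) (λ u → sum (t u)))

      form-expand : ∀ x y → ⟨ x , A · y ⟩ ≈ ∑∑ λ u v → x u * (A u v * y v)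
      form-expand x y = sum-cong-≋ λ u → *-distribˡ-sum {n} (x u) _

      -- With A f = 0, the form at the pointwise product x f is
      -- - 1/2 ∑ A u v (f u) (f v) (x u - x v)².
      form-nonpositive : ∀ f → A · f ≋ (λ _ → 0#) → (x : Vector Carrier n) →
                         (∀ {u v} → Adj u v → x u ≈ x v ⊎ f u * f v ≤ 0#) →
                         ⟨ (λ v → x v * f v) , (A · λ v → x v * f v) ⟩ ≤ 0#
      form-nonpositive f Af≈0 x edges = ≮⇒≥ λ 0<Q →
        <⇒≉ (+-pos-nonneg (+-pos-nonneg 0<Q (inj₁ 0<Q)) D≥0) (≈-trans (+-comm _ _) D+2Q≈0)
        where
        xf xxf : Vector Carrier n
        xf v = x v * f v
        xxf v = x v * x v * f v

        -- Naming the difference lets x u be replaced by y u v + x v, which turns the polynomial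
        -- identity below into one without subtraction.
        y : Fin n → Fin n → Carrier
        y u v = x u + - x v

        x≈y+x : ∀ u v → x u ≈ y u v + x v
        x≈y+x u v = ≈-sym (≈-trans (+-assoc _ _ _) (≈-trans (+-congˡ (-‿inverseˡ (x v))) (+-identityʳ (x u))))

        d t s s′ : Fin n → Fin n → Carrier
        d u v = A u v * (f u * f v * (y u v * y u v))
        t u v = xf u * (A u v * xf v)
        s u v = xxf u * (A u v * f v)
        s′ u v = f u * (A u v * xxf v)

        -- Expand the square in `d`: the mixed term cancels the two copies of the form at x f, and
        -- the two square terms remain. Summed, these pair x² f with A f, directly and through
        -- self-adjointness, and so vanish. Keeping Q + Q avoids halving.
        pointwise : ∀ u v → d u v + (t u v + t u v) ≈ s u v + s′ u v
        pointwise u v = begin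
          d u v + (t u v + t u v)    ≈⟨ +-congˡ (+-cong t≈ t≈) ⟩
          d u v + (t₀ + t₀)          ≈⟨ solve 5 (λ a f g y x →
                                          a :* (f :* g :* (y :* y)) :+ ((y :+ x) :* f :* (a :* (x :* g)) :+ (y :+ x) :* f :* (a :* (x :* g)))
                                          := (y :+ x) :* (y :+ x) :* f :* (a :* g) :+ f :* (a :* (x :* x :* g)))
                                          ≈-refl (A u v) (f u) (f v) (y u v) (x v) ⟩
          s₀ + s′ u v                ≈⟨ +-congʳ (*-congʳ (*-congʳ (*-cong (x≈y+x u v) (x≈y+x u v)))) ⟨
          s u v + s′ u v             ∎
          where
          t₀ = (y u v + x v) * f u * (A u v * xf v)
          s₀ = (y u v + x v) * (y u v + x v) * f u * (A u v * f v)
          t≈ : t u v ≈ t₀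
          t≈ = *-congʳ (*-congʳ (x≈y+x u v))

        Q = ⟨ xf , A · xf ⟩

        D+2Q≈0 : ∑∑ d + (Q + Q) ≈ 0#
        D+2Q≈0 = begin
          ∑∑ d + (Q + Q)                       ≈⟨ +-congˡ (+-cong (form-expand xf xf) (form-expand xf xf)) ⟩
          ∑∑ d + (∑∑ t + ∑∑ t)                 ≈⟨ +-congˡ (∑∑-+ t t) ⟨
          ∑∑ d + ∑∑ (λ u v → t u v + t u v)    ≈⟨ ∑∑-+ d _ ⟨
          ∑∑ (λ u v → d u v + (t u v + t u v))  ≈⟨ ∑∑-cong pointwise ⟩
          ∑∑ (λ u v → s u v + s′ u v)          ≈⟨ ∑∑-+ s s′ ⟩
          ∑∑ s + ∑∑ s′                         ≈⟨ +-cong (form-expand xxf f) (form-expand f xxf) ⟨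
          ⟨ xxf , A · f ⟩ + ⟨ f , A · xxf ⟩    ≈⟨ +-congˡ (self-adjoint A symmetric f xxf) ⟨
          ⟨ xxf , A · f ⟩ + ⟨ A · f , xxf ⟩    ≈⟨ +-congˡ (⟨⟩-comm (A · f) xxf) ⟩
          ⟨ xxf , A · f ⟩ + ⟨ xxf , A · f ⟩    ≈⟨ +-cong (⟨⟩-zeroʳ xxf Af≈0) (⟨⟩-zeroʳ xxf Af≈0) ⟩
          0# + 0#                              ≈⟨ +-identityˡ 0# ⟩
          0#                                   ∎

        equal⇒d≥0 : ∀ {u v} → x u ≈ x v → 0# ≤ d u v
        equal⇒d≥0 {u} {v} x≈ = inj₂ (≈-sym (begin
          A u v * (f u * f v * (y u v * y u v))  ≈⟨ *-congˡ (*-congˡ (*-congʳ (≈-trans (+-congʳ x≈) (-‿inverseʳ (x v))))) ⟩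
          A u v * (f u * f v * (0# * y u v))     ≈⟨ *-congˡ (≈-trans (*-congˡ (zeroˡ _)) (zeroʳ _)) ⟩
          A u v * 0#                             ≈⟨ zeroʳ _ ⟩
          0#                                     ∎))

        d≥0 : ∀ u v → 0# ≤ d u v
        d≥0 u v with u Fin.≟ v
        ... | yes refl = equal⇒d≥0 ≈-refl
        ... | no u≢v with adj? u v
        ...   | no u≁v = inj₂ (≈-sym (≈-trans (*-congʳ (nonadjacent≈0 u≢v u≁v)) (zeroˡ _)))
        ...   | yes u~v with edges u~v
        ...     | inj₁ x≈   = equal⇒d≥0 x≈
        ...     | inj₂ ff≤0 = *-nonpos (inj₁ (edge<0 u~v)) (*-nonpos-nonneg ff≤0 (square-nonneg (y u v)))

        D≥0 : 0# ≤ ∑∑ d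
        D≥0 = sum-nonneg _ λ u → sum-nonneg _ (d≥0 u)

      module Domains
        (f : Vector Carrier n) (Af≈0 : A · f ≋ λ _ → 0#) (shallow : ∀ v → Urschel f v → Shallow G f v)
        {g : Vector Carrier n} (signing : IsSigning f g)
        {p q : ℕ} (positives : ComponentCount G (λ v → 0# < g v) p) (negatives : ComponentCount G (λ v → g v < 0#) q) where

        open IsSigning signing
        module P = Bijection positives
        module Q = Bijection negatives

        classify : ∀ v → 0# < g v ⊎ g v < 0# → Fin (p ℕ.+ q)
        classify v (inj₁ 0<g) = P.to (v , 0<g) ↑ˡ q
        classify v (inj₂ g<0) = p ↑ʳ Q.to (v , g<0)

        domain : Fin n → Fin (p ℕ.+ q)
        domain v = classify v (≉⇒<⊎> (nowhereZero v))

        domain-positive : ∀ v (0<g : 0# < g v) → domain v ≡ P.to (v , 0<g) ↑ˡ q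
        domain-positive v 0<g with ≉⇒<⊎> (nowhereZero v)
        -- The two positivity proofs may differ, but they belong to the same vertex, so the empty
        -- walk identifies them.
        ... | inj₁ 0<g′ = ≡.cong (_↑ˡ q) (P.cong {v , 0<g′} {v , 0<g} ε)
        ... | inj₂ g<0  = contradiction g<0 (asym 0<g)

        domain-negative : ∀ v (g<0 : g v < 0#) → domain v ≡ p ↑ʳ Q.to (v , g<0)
        domain-negative v g<0 with ≉⇒<⊎> (nowhereZero v)
        ... | inj₁ 0<g  = contradiction g<0 (asym 0<g)
        ... | inj₂ g<0′ = ≡.cong (p ↑ʳ_) (Q.cong {v , g<0′} {v , g<0} ε)

        adjacent-positive : ∀ {u v} → Adj u v → 0# < g u → 0# < g v → domain u ≡ domain v
        adjacent-positive {u} {v} u~v 0<gu 0<gv = ≡.trans (domain-positive u 0<gu)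
          (≡.trans (≡.cong (_↑ˡ q) (P.cong {u , 0<gu} {v , 0<gv} ((0<gu , 0<gv , u~v) ◅ ε))) (≡.sym (domain-positive v 0<gv)))

        adjacent-negative : ∀ {u v} → Adj u v → g u < 0# → g v < 0# → domain u ≡ domain v
        adjacent-negative {u} {v} u~v gu<0 gv<0 = ≡.trans (domain-negative u gu<0)
          (≡.trans (≡.cong (p ↑ʳ_) (Q.cong {u , gu<0} {v , gv<0} ((gu<0 , gv<0 , u~v) ◅ ε))) (≡.sym (domain-negative v gv<0)))

        f≥0 : ∀ {v} → 0# < g v → 0# ≤ f v
        f≥0 {v} 0<g = ≯⇒≤ λ f<0 → asym 0<g (onNegative v f<0)

        f≤0 : ∀ {v} → g v < 0# → f v ≤ 0#
        f≤0 {v} g<0 = ≮⇒≥ λ 0<f → asym (onPositive v 0<f) g<0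

        -- Prepares the edge hypothesis of `form-nonpositive`. An edge along which `g` keeps its
        -- sign stays inside a domain; along any other edge `f` has weakly opposite signs, since it
        -- never has the sign opposite to `g`.
        adjacent : ∀ {u v} → Adj u v → domain u ≡ domain v ⊎ f u * f v ≤ 0#
        adjacent {u} {v} u~v = decide (≉⇒<⊎> (nowhereZero u)) (≉⇒<⊎> (nowhereZero v))
          where
          decide : 0# < g u ⊎ g u < 0# → 0# < g v ⊎ g v < 0# → domain u ≡ domain v ⊎ f u * f v ≤ 0#
          decide (inj₁ 0<gu) (inj₁ 0<gv) = inj₁ (adjacent-positive u~v 0<gu 0<gv)
          decide (inj₂ gu<0) (inj₂ gv<0) = inj₁ (adjacent-negative u~v gu<0 gv<0)
          decide (inj₂ gu<0) (inj₁ 0<gv) = inj₂ (*-nonpos-nonneg (f≤0 gu<0) (f≥0 0<gv))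
          decide (inj₁ 0<gu) (inj₂ gv<0) = inj₂ (≤0-resp (*-nonpos-nonneg (f≤0 gv<0) (f≥0 0<gu)))
            where
            ≤0-resp : f v * f u ≤ 0# → f u * f v ≤ 0#
            ≤0-resp (inj₁ <0) = inj₁ (<-respˡ-≈ (*-comm _ _) <0)
            ≤0-resp (inj₂ ≈0) = inj₂ (≈-trans (*-comm _ _) ≈0)

        representative : ∀ i → ∃ λ v → domain v ≡ i × f v ≉ 0#
        representative i = ≡.subst (λ i → ∃ λ v → domain v ≡ i × f v ≉ 0#) (Fin.join-splitAt p q i) (find (splitAt p i))
          where
          -- From a zero of `f`, move to a neighbour where `f` has the sign that `g` has here. The
          -- signing keeps that sign at the neighbour, so the move does not leave the domain.
          escape : ∀ v → 0# < g v ⊎ g v < 0# → Dec (f v ≈ 0#) → ∃ λ w → domain w ≡ domain v × f w ≉ 0#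
          escape v _           (no f≉0)  = v , refl , f≉0
          escape v (inj₁ 0<gv) (yes f≈0) =
            map₂ (λ {w} (v~w , 0<fw) → ≡.sym (adjacent-positive v~w 0<gv (onPositive w 0<fw)) , <⇒≉ 0<fw)
              (positive-neighbour f v (Af≈0 v) f≈0 (proj₂ (shallow v f≈0)))
          escape v (inj₂ gv<0) (yes f≈0) =
            map₂ (λ {w} (v~w , fw<0) → ≡.sym (adjacent-negative v~w gv<0 (onNegative w fw<0)) , >⇒≉ fw<0)
              (negative-neighbour f v (Af≈0 v) f≈0 (proj₂ (shallow v f≈0)))

          find : ∀ s → ∃ λ v → domain v ≡ join p q s × f v ≉ 0#
          find (inj₁ j) = map₂ (λ (same , f≉0) → ≡.trans same
                                    (≡.trans (domain-positive v 0<g) (≡.cong (_↑ˡ q) (proj₂ (P.strictlySurjective j)))) , f≉0)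
                               (escape v (inj₁ 0<g) (f v ≟ 0#))
            where
            v = proj₁ (proj₁ (P.strictlySurjective j))
            0<g = proj₂ (proj₁ (P.strictlySurjective j))
          find (inj₂ j) = map₂ (λ (same , f≉0) → ≡.trans same
                                    (≡.trans (domain-negative v g<0) (≡.cong (p ↑ʳ_) (proj₂ (Q.strictlySurjective j)))) , f≉0)
                               (escape v (inj₂ g<0) (f v ≟ 0#))
            where
            v = proj₁ (proj₁ (Q.strictlySurjective j))
            g<0 = proj₂ (proj₁ (Q.strictlySurjective j))

        -- The identity entry serves as the indicator of domain `i`. A combination thus collapses to
        -- the pointwise product of `f` with `c ∘ domain`, the shape that `form-nonpositive`
        -- expects.
        restriction : Fin (p ℕ.+ q) → Vector Carrier n
        restriction i v = identity (domain v) i * f v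

        combination-restriction : ∀ c → combination c restriction ≋ λ v → c (domain v) * f v
        combination-restriction c v = begin
          ∑[ i < m ] (c i * (identity (domain v) i * f v))  ≈⟨ sum-cong-≋ (λ i → solve 3 (λ a b d → a :* (b :* d) := d :* (b :* a)) ≈-refl (c i) (identity (domain v) i) (f v)) ⟩
          ∑[ i < m ] (f v * (identity (domain v) i * c i))  ≈⟨ *-distribˡ-sum {m} (f v) _ ⟨
          f v * (identity · c) (domain v)                   ≈⟨ *-congˡ (identity-single (domain v) c) ⟩
          f v * c (domain v)                                ≈⟨ *-comm _ _ ⟩
          c (domain v) * f v                                ∎
          where m = p ℕ.+ q

        restriction-independent : ∀ c → combination c restriction ≋ (λ _ → 0#) → ∀ i → c i ≈ 0#
        restriction-independent c ≈0 i = ≡.subst (λ i → c i ≈ 0#) v∈i (*-cancel-zeroˡ f≉0 (begin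
          f v * c (domain v)          ≈⟨ *-comm _ _ ⟩
          c (domain v) * f v          ≈⟨ combination-restriction c v ⟨
          combination c restriction v  ≈⟨ ≈0 v ⟩
          0#                          ∎))
          where
          v = proj₁ (representative i)
          v∈i = proj₁ (proj₂ (representative i))
          f≉0 = proj₂ (proj₂ (representative i))

        restriction-nonpositive : ∀ c → ⟨ combination c restriction , A · combination c restriction ⟩ ≤ 0#
        restriction-nonpositive c = ≮⇒≥ λ 0<Q →
          ≤0⇒≯0 (form-nonpositive f Af≈0 (c ∘ domain) edges)
            (<-respʳ-≈ (⟨⟩-cong (combination-restriction c) (·-cong A (combination-restriction c))) 0<Q)
          where
          edges : ∀ {u v} → Adj u v → c (domain u) ≈ c (domain v) ⊎ f u * f v ≤ 0#
          edges u~v = map₁ (λ eq → reflexive (≡.cong c eq)) (adjacent u~v)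

  -- Consequences of simplicity: perturbation and nodal bound

  module SimpleEigenvalue
    {n : ℕ} (G : Graph n) {M : Matrix n} (L : IsGeneralizedLaplacian G M)
    {ev : Vector Carrier n} (isSpectrum : IsSpectrum M ev)
    (k : Fin n) (simple : IsSimpleEigenvalue M (ev k))
    {f : Vector Carrier n} (f-eigenvector : IsEigenvector M (ev k) f)
    (shallow : ∀ v → Urschel f v → Shallow G f v) where

    open Graph G using (Adj)
    open IsGeneralizedLaplacian L
    open Nodal G
    open Spectrum M symmetric ev isSpectrum
    open IsSpectrum isSpectrum using (ordered)

    A : Matrix n
    A = M -[ ev k ]I

    A-isGeneralizedLaplacian : IsGeneralizedLaplacian G A
    A-isGeneralizedLaplacian = shift-isGeneralizedLaplacian L (ev k)

    A-sym : A ᵀ ≋ᴹ A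
    A-sym = IsGeneralizedLaplacian.symmetric A-isGeneralizedLaplacian

    f≉0 : ¬ (f ≋ λ _ → 0#)
    f≉0 = proj₁ f-eigenvector

    Af≈0 : A · f ≋ λ _ → 0#
    Af≈0 = Eigenspace⇒kernel M (ev k) (proj₂ f-eigenvector)

    -- Simplicity provides some basis vector b, not necessarily `f`. Since `f` is a nonzero multiple
    -- of b, the coefficient can be inverted and b exchanged for `f`.
    spanned : ∀ x → Eigenspace M (ev k) x → ∃ λ c → x ≋ λ v → c * f v
    spanned x Mx≈λx = a x Mx≈λx * s , λ v → begin
      x v                ≈⟨ x≈ab x Mx≈λx v ⟩
      a x Mx≈λx * b v    ≈⟨ *-congˡ (b≈sf v) ⟩
      a x Mx≈λx * (s * f v)  ≈⟨ *-assoc _ _ _ ⟨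
      a x Mx≈λx * s * f v  ∎
      where
      open IsBasis (proj₂ simple) using (spanning)

      b : Vector Carrier n
      b = proj₁ simple zero

      a : ∀ y → Eigenspace M (ev k) y → Carrier
      a y My≈λy = proj₁ (spanning y My≈λy) zero

      x≈ab : ∀ y My≈λy v → y v ≈ a y My≈λy * b v
      x≈ab y My≈λy v = ≈-trans (proj₂ (spanning y My≈λy) v) (+-identityʳ _)

      c = a f (proj₂ f-eigenvector)

      c≉0 : c ≉ 0#
      c≉0 c≈0 = f≉0 λ v → ≈-trans (x≈ab f (proj₂ f-eigenvector) v) (≈-trans (*-congʳ c≈0) (zeroˡ (b v)))

      s = proj₁ (inverse c c≉0)

      b≈sf : ∀ v → b v ≈ s * f v
      b≈sf v = begin
        b v              ≈⟨ *-identityˡ _ ⟨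
        1# * b v         ≈⟨ *-congʳ (proj₂ (inverse c c≉0)) ⟨
        c * s * b v      ≈⟨ solve 3 (λ c s b → c :* s :* b := s :* (c :* b)) ≈-refl c s (b v) ⟩
        s * (c * b v)    ≈⟨ *-congˡ (x≈ab f (proj₂ f-eigenvector) v) ⟨
        s * f v          ∎

    open Pseudoinverse A A-sym f f≉0 Af≈0 (λ x Ax≈0 → spanned x (kernel⇒Eigenspace M (ev k) Ax≈0))
      using (A⁺; isMoorePenrose; A⁺·A·; project-fixed; N≉0) public

    perturbation : (f₁ : Vector Carrier n) → (∀ v → ¬ Urschel f v → f₁ v ≈ 0#) →
                   ∃ λ (M₁ : Matrix n) → SupportedOn G M₁ × f₁ ≋ A⁺ · (M₁ · f)
    perturbation f₁ f₁≈0 = M₁ , M₁-supported , λ v → ≈-sym (begin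
      (A⁺ · M₁ · f) v     ≈⟨ ·-cong A⁺ M₁f≈Af₁ v ⟩
      (A⁺ · A · f₁) v     ≈⟨ A⁺·A· f₁ v ⟩
      _                   ≈⟨ project-fixed f₁ ff₁≈0 v ⟩
      f₁ v                ∎)
      where
      ff₁≈0 : ⟨ f , f₁ ⟩ ≈ 0#
      ff₁≈0 = sum-zero _ λ v → decide v (f v ≟ 0#)
        where
        decide : ∀ v → Dec (f v ≈ 0#) → f v * f₁ v ≈ 0#
        decide v (yes f≈0) = ≈-trans (*-congʳ f≈0) (zeroˡ _)
        decide v (no ≉0)   = ≈-trans (*-congˡ (f₁≈0 v ≉0)) (zeroʳ _)

      pivot : ∀ u → ∃ λ w → (u ≢ w → Adj u w) × f w ≉ 0#
      pivot u = decide (f u ≟ 0#)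
        where
        decide : Dec (f u ≈ 0#) → ∃ λ w → (u ≢ w → Adj u w) × f w ≉ 0#
        decide (yes f≈0) = map₂ (λ (u~w , ≉0) → (λ _ → u~w) , ≉0) (proj₂ (shallow u f≈0))
        decide (no ≉0)   = u , contradiction refl , ≉0

      target : Fin n → Fin n
      target u = proj₁ (pivot u)

      f⁻¹ : ∀ u → ∃ λ y → f (target u) * y ≈ 1#
      f⁻¹ u = inverse (f (target u)) (proj₂ (proj₂ (pivot u)))

      -- Row u of M₁ f reduces to this number times f (target u), hence the division.
      scale : Vector Carrier n
      scale u = (A · f₁) u * proj₁ (f⁻¹ u)

      M₁ : Matrix n
      M₁ u v = scale u * identity (target u) v

      M₁-supported : SupportedOn G M₁
      M₁-supported {u} {v} M₁≉0 u≢v = decide (target u Fin.≟ v)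
        where
        decide : Dec (target u ≡ v) → Adj u v
        decide (yes w≡v) = ≡.subst (Adj u) w≡v (proj₁ (proj₂ (pivot u)) λ u≡w → u≢v (≡.trans u≡w w≡v))
        decide (no w≢v)  = contradiction (≈-trans (*-congˡ (identity-offDiagonal w≢v)) (zeroʳ _)) M₁≉0

      M₁f≈Af₁ : M₁ · f ≋ A · f₁
      M₁f≈Af₁ u = begin
        (M₁ · f) u                                        ≈⟨ ⟨⟩-*ˡ (scale u) (identity (target u)) f ⟩
        scale u * (identity · f) (target u)               ≈⟨ *-congˡ (identity-single (target u) f) ⟩
        (A · f₁) u * proj₁ (f⁻¹ u) * f (target u)         ≈⟨ ≈-trans (*-assoc _ _ _) (*-congˡ (*-comm _ _)) ⟩
        (A · f₁) u * (f (target u) * proj₁ (f⁻¹ u))       ≈⟨ *-congˡ (proj₂ (f⁻¹ u)) ⟩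
        (A · f₁) u * 1#                                   ≈⟨ *-identityʳ _ ⟩
        (A · f₁) u                                        ∎

    signVector : (s : Fin n → SignValue) →
                 ∃ λ (f₁ : Vector Carrier n) → (∀ v → ¬ Urschel f v → f₁ v ≈ 0#) × (∀ v → Urschel f v → HasSign (s v) (f₁ v))
    signVector s = (λ v → proj₁ (choice v)) , (λ v → proj₁ (proj₂ (choice v))) , (λ v → proj₂ (proj₂ (choice v)))
      where
      value : ∀ σ → ∃ (HasSign σ)
      value negative = - 1# , pos-neg 0<1
      value null     = 0# , ≈-refl
      value positive = 1# , 0<1

      choice : ∀ v → ∃ λ x → (¬ Urschel f v → x ≈ 0#) × (Urschel f v → HasSign (s v) x)
      choice v with f v ≟ 0#
      ... | yes f≈0 = map₂ (λ sign → (λ ≉0 → contradiction f≈0 ≉0) , λ _ → sign) (value (s v))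
      ... | no ≉0   = 0# , (λ _ → ≈-refl) , λ f≈0 → contradiction f≈0 ≉0

    open OrthogonalEigenvectors (orthogonalEigenvectors n ℕ.≤-refl)

    -- The ordering alone gives a weak inequality. Equality would make `vector k` and `vector j`
    -- nonzero multiples of `f`, whose inner product could not be zero.
    ev-strict : ∀ j → toℕ k ℕ.< toℕ j → 0# < ev j + - ev k
    ev-strict j k<j = positive-difference (ordered (ℕ.<⇒≤ k<j))
      where
      notEqual : ¬ (ev k ≈ ev j)
      notEqual evk≈evj = nonproportional (spanned (vector k) (eigen k (Fin.toℕ<n k)))
        (spanned (vector j) (Eigenspace-resp M (≈-sym evk≈evj) (eigen j (Fin.toℕ<n j))))
        where
        nonzero-coefficient : ∀ i {c} → (vector i ≋ λ v → c * f v) → c ≉ 0#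
        nonzero-coefficient i b≈cf c≈0 = nonzero i (Fin.toℕ<n i) λ v → ≈-trans (b≈cf v) (≈-trans (*-congʳ c≈0) (zeroˡ (f v)))

        nonproportional : (∃ λ c → vector k ≋ λ v → c * f v) → ¬ (∃ λ d → vector j ≋ λ v → d * f v)
        nonproportional (c , bk≈cf) (d , bj≈df) =
          *-≉0 (nonzero-coefficient k bk≈cf) (*-≉0 (nonzero-coefficient j bj≈df) N≉0) (begin
            c * (d * ⟨ f , f ⟩)                      ≈⟨ *-congˡ (⟨⟩-*ʳ f d f) ⟨
            c * ⟨ f , (λ v → d * f v) ⟩              ≈⟨ ⟨⟩-*ˡ c f _ ⟨
            ⟨ (λ v → c * f v) , (λ v → d * f v) ⟩    ≈⟨ ⟨⟩-cong bk≈cf bj≈df ⟨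
            ⟨ vector k , vector j ⟩                  ≈⟨ orthogonal k j (Fin.toℕ<n k) (Fin.toℕ<n j) (λ k≡j → ℕ.<-irrefl (≡.cong toℕ k≡j) k<j) ⟩
            0#                                       ∎)

      positive-difference : ev k ≤ ev j → 0# < ev j + - ev k
      positive-difference (inj₁ k<j) = <-respˡ-≈ (-‿inverseʳ (ev k)) (+-monoˡ (- ev k) k<j)
      positive-difference (inj₂ k≈j) = contradiction k≈j notEqual

    nodalBound : ∀ g m → IsSigning f g → SND G g m → m ℕ.≤ suc (toℕ k)
    nodalBound g m signing (p , q , positives , negatives , refl) =
      ≡.subst (m ℕ.≤_) (ℕ.m∸[m∸n]≡n (Fin.toℕ<n k)) (ℕ.m+n≤o⇒m≤o∸n m dimensions)
      where
      -- As `k` is 0-based, the eigenvalues above ev k have the indices toℕ k + 1, ..., n - 1. With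
      -- m domains, `dimensions` reads m + r ≤ n, that is, m ≤ toℕ k + 1.
      r = n ℕ.∸ suc (toℕ k)

      upper< : ∀ (j : Fin r) → suc (toℕ k) ℕ.+ toℕ j ℕ.< n
      upper< j = ≡.subst (suc (toℕ k) ℕ.+ toℕ j ℕ.<_) (ℕ.m+[n∸m]≡n (Fin.toℕ<n k)) (ℕ.+-monoʳ-< (suc (toℕ k)) (Fin.toℕ<n j))

      upper : Fin r → Fin n
      upper j = fromℕ< (upper< j)

      k<upper : ∀ j → toℕ k ℕ.< toℕ (upper j)
      k<upper j = ≡.subst (toℕ k ℕ.<_) (≡.sym (Fin.toℕ-fromℕ< (upper< j))) (ℕ.s≤s (ℕ.m≤m+n (toℕ k) (toℕ j)))

      upper-injective : ∀ {i j} → upper i ≡ upper j → i ≡ j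
      upper-injective {i} {j} eq = Fin.toℕ-injective (ℕ.+-cancelˡ-≡ (suc (toℕ k)) _ _
        (Fin.fromℕ<-injective _ _ (upper< i) (upper< j) eq))

      open Domains A-isGeneralizedLaplacian f Af≈0 shallow signing positives negatives
        using (restriction; restriction-independent; restriction-nonpositive)

      open Inertia A A-sym (λ j → ev (upper j) + - ev k) (λ j → ev-strict (upper j) (k<upper j)) (vector ∘ upper)
        (λ j → shift-eigenvector M (ev k) (eigen (upper j) (Fin.toℕ<n (upper j))))
        (λ j → nonzero (upper j) (Fin.toℕ<n (upper j)))
        (λ i j i≢j → orthogonal (upper i) (upper j) (Fin.toℕ<n (upper i)) (Fin.toℕ<n (upper j)) (i≢j ∘ upper-injective))
        restriction restriction-independent restriction-nonpositive
        using (dimensions)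

  -- Signings

  module Signings {n : ℕ} (G : Graph n) (f : Vector Carrier n) where

    unitSign : Bool → Carrier
    unitSign true  = 1#
    unitSign false = - 1#

    -- A finite supply of signings that realises every sign pattern on the Urschel vertices. Entries
    -- of `t` at other vertices have no effect, so patterns may repeat, which is harmless for a
    -- maximum.
    signing : Vec Bool n → Vector Carrier n
    signing t v with f v ≟ 0#
    ... | yes _ = unitSign (Vec.lookup t v)
    ... | no _  = f v

    signing-isSigning : ∀ t → IsSigning f (signing t)
    signing-isSigning t = record { nowhereZero = nowhereZero ; onPositive = onPositive ; onNegative = onNegative }
      where
      nowhereZero : ∀ v → signing t v ≉ 0#
      nowhereZero v with f v ≟ 0#
      ... | no ≉0 = ≉0
      ... | yes _ with Vec.lookup t v
      ...   | true  = <⇒≉ 0<1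
      ...   | false = >⇒≉ (pos-neg 0<1)

      onPositive : ∀ v → 0# < f v → 0# < signing t v
      onPositive v 0<f with f v ≟ 0#
      ... | no _    = 0<f
      ... | yes f≈0 = contradiction f≈0 (<⇒≉ 0<f)

      onNegative : ∀ v → f v < 0# → signing t v < 0#
      onNegative v f<0 with f v ≟ 0#
      ... | no _    = f<0
      ... | yes f≈0 = contradiction f≈0 (>⇒≉ f<0)

    snd : ∀ g → ∃ (SND G g)
    snd g = _ , proj₁ P , proj₁ N , proj₂ P , proj₂ N , refl
      where
      P = componentCount G (λ v → 0# < g v) (λ v → 0# <? g v)
      N = componentCount G (λ v → g v < 0#) (λ v → g v <? 0#)

    -- Bounds the count of an arbitrary signing by the count chosen for the finite family member
    -- with the same signs; `SND` being a relation, even equal sign patterns call for this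
    -- comparison.
    snd-mono : ∀ {g h i j} → (∀ v → (0# < g v × 0# < h v) ⊎ (g v < 0# × h v < 0#)) →
               SND G g i → SND G h j → i ℕ.≤ j
    snd-mono {g} {h} same (_ , _ , P , N , refl) (_ , _ , P′ , N′ , refl) =
      ℕ.+-mono-≤ (componentCount-mono G (λ {v} → pos⇒ v) (λ {v} → pos⇐ v) P P′)
                 (componentCount-mono G (λ {v} → neg⇒ v) (λ {v} → neg⇐ v) N N′)
      where
      pos⇒ : ∀ v → 0# < g v → 0# < h v
      pos⇒ v 0<g with same v
      ... | inj₁ (_ , 0<h) = 0<h
      ... | inj₂ (g<0 , _) = contradiction g<0 (asym 0<g)

      pos⇐ : ∀ v → 0# < h v → 0# < g v
      pos⇐ v 0<h with same v
      ... | inj₁ (0<g , _) = 0<g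
      ... | inj₂ (_ , h<0) = contradiction h<0 (asym 0<h)

      neg⇒ : ∀ v → g v < 0# → h v < 0#
      neg⇒ v g<0 with same v
      ... | inj₁ (0<g , _) = contradiction g<0 (asym 0<g)
      ... | inj₂ (_ , h<0) = h<0

      neg⇐ : ∀ v → h v < 0# → g v < 0#
      neg⇐ v h<0 with same v
      ... | inj₁ (_ , 0<h) = contradiction h<0 (asym 0<h)
      ... | inj₂ (g<0 , _) = g<0

    positivity : Vector Carrier n → Vec Bool n
    positivity g = Vec.tabulate λ v → does (0# <? g v)

    same-sign : ∀ {g} → IsSigning f g → ∀ v →
                (0# < g v × 0# < signing (positivity g) v) ⊎ (g v < 0# × signing (positivity g) v < 0#)
    same-sign {g} isSigning v with f v ≟ 0#
    ... | yes _ rewrite lookup∘tabulate (λ v → does (0# <? g v)) v with 0# <? g v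
    ...   | yes 0<g = inj₁ (0<g , 0<1)
    ...   | no 0≮g with ≉⇒<⊎> (IsSigning.nowhereZero isSigning v)
    ...     | inj₁ 0<g = contradiction 0<g 0≮g
    ...     | inj₂ g<0 = inj₂ (g<0 , pos-neg 0<1)
    same-sign {g} isSigning v | no f≉0 with ≉⇒<⊎> f≉0
    ... | inj₁ 0<f = inj₁ (IsSigning.onPositive isSigning v 0<f , 0<f)
    ... | inj₂ f<0 = inj₂ (IsSigning.onNegative isSigning v f<0 , f<0)

    maximumUrschelNumber : ∃ (UNmax G f)
    maximumUrschelNumber = proj₁ (snd (signing t))
      , (signing t , signing-isSigning t , proj₂ (snd (signing t)))
      , λ g j isSigning sndg →
          ℕ.≤-trans (snd-mono (same-sign isSigning) sndg (proj₂ (snd (signing (positivity g))))) (t-max (positivity g))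
      where
      best = maximum λ t → proj₁ (snd (signing t))
      t = proj₁ best
      t-max = proj₂ best

theorem2p9 :
    (R : Reals) → let open Reals R in let open OverReals R in
    {n : ℕ} (G : Graph n) → Connected G →
    (M : Matrix n) → IsGeneralizedLaplacian G M →
    (ev : Vector Carrier n) → IsSpectrum M ev →
    -- k is 0-based: ev k is the eigenvalue of index suc (toℕ k)
    (k : Fin n) → IsSimpleEigenvalue M (ev k) →
    (f : Vector Carrier n) → IsEigenvector M (ev k) f →
    ∃ (Urschel f) → (∀ v → Urschel f v → Shallow G f v) →
    (∃ λ (A⁺ : Matrix n) → IsMoorePenrose (M -[ ev k ]I) A⁺ ×
      ((f₁ : Vector Carrier n) → (∀ v → ¬ Urschel f v → f₁ v ≈ 0#) →
        ∃ λ (M₁ : Matrix n) → SupportedOn G M₁ × f₁ ≋ A⁺ · (M₁ · f)) ×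
      ((s : Fin n → SignValue) →
        ∃ λ (f₁ : Vector Carrier n) → (∀ v → ¬ Urschel f v → f₁ v ≈ 0#) ×
          (∀ v → Urschel f v → HasSign (s v) (f₁ v)) ×
          ∃ λ (M₁ : Matrix n) → SupportedOn G M₁ × f₁ ≋ A⁺ · (M₁ · f))) ×
    (∃ λ m → UNmax G f m × m ℕ.≤ suc (toℕ k))
theorem2p9 R G _ M L ev isSpectrum k simple f eigenvector _ shallow =
  (A⁺ , isMoorePenrose , perturbation , λ s → map₂ (λ (outside , signs) → outside , signs , perturbation _ outside) (signVector s)) ,
  map₂ (λ un@((g , signing , snd) , _) → un , nodalBound g _ signing snd) maximumUrschelNumber
  where
  open SimpleEigenvalue R G L isSpectrum k simple eigenvector shallow
  open Signings R G f using (maximumUrschelNumber)
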